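{- For all $n,d,k\in\mathbb{N}$, $T(n,\omega^d\cdot k)\ge P(n,\omega^d\cdot k)$. Consequently $T(n,\omega^d\cdot k)=P(n,\omega^d\cdot k)$.
   Context: $[c]=\{1,\dots,c\}$; ordinals are identified with sets of smaller ordinals; $\approx$ is order-equivalence; $\binom{S}{n}$ is the set of $n$-element subsets. $T(n,S)$ is the least $t\in\mathbb{N}$ such that for every $c\ge1$ and every $\mathrm{COL}:\binom{S}{n}\to[c]$ there is $S'\subseteq S$, $S'\approx S$, with $|\mathrm{COL}(\binom{S'}{n})|\le t$ ($\infty$ if none). Every $\beta<\omega^d\cdot k$ is uniquely $\omega^d b+\sum_{j<d}\omega^j a_j$ with $0\le b<k$, $a_j\in\mathbb{N}$. A coloring rule (CR) on $\binom{\omega^d\cdot k}{n}$ is a pair $(\mathcal{Y},\preceq)$ with $\mathcal{Y}:\{1,\dots,n\}\to\{0,\dots,k-1\}$ and $\preceq$ a total preorder on $I=\{(i,j):1\le i\le n,0\le j<d\}$ (with induced equivalence $\equiv$ and strict part $\prec$) such that: (1) if $d\ge1$, $(i,0)\prec(i',0)$ for $i<i'$; if $d=0$, $\mathcal{Y}(i)<\mathcal{Y}(i')$ for $i<i'$; (2) $(i,j)\equiv(i',j)$ for some $j$ implies $\mathcal{Y}(i)=\mathcal{Y}(i')$; (3) $(i,j)\prec(i,j')$ for $j>j'$; (4) $(i,j)\equiv(i',j')$ implies $j=j'$; (5) for $j>0$, $(i,j)\not\equiv(i',j)$ implies $(i,j-1)\not\equiv(i',j-1)$. $P(n,\omega^d\cdot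 k)$ is the total number of CRs on $\binom{\omega^d\cdot k}{n}$. -}

module Defs where

open import Data.Bool.Base using (Bool; true; false; T)
open import Data.Bool.Properties using (T?)
open import Data.Fin.Base as Fin using (Fin; toℕ)
import Data.Fin.Induction as Fin
open import Data.Fin.Properties as Fin using (all?)
open import Data.Fin.Subset as Subset using (Subset; ∣_∣)
open import Data.List.Base
  using (List; []; _∷_; allFin; cartesianProduct; cartesianProductWith; filter; length)
open import Data.List.Membership.Propositional using (_∈_)
open import Data.List.Membership.Propositional.Properties
  using (∈-allFin; ∈-cartesianProduct⁺; ∈-cartesianProductWith⁺; ∈-filter⁺; ∈-filter⁻)
open import Data.List.Relation.Unary.All using ([]; _∷_)
open import Data.List.Relation.Unary.AllPairs using ([]; _∷_)
open import Data.List.Relation.Unary.Any using (here; there)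
open import Data.List.Relation.Unary.Unique.Propositional using (Unique)
import Data.List.Relation.Unary.Unique.Propositional.Properties as Unique
open import Data.Nat.Base as ℕ using (ℕ; zero; suc)
import Data.Nat.Induction as ℕ
import Data.Nat.Properties as ℕ
open import Data.Product.Base using (Σ; ∃; _×_; _,_; proj₁; proj₂)
open import Data.Product.Relation.Binary.Lex.Strict
  using (×-Lex; ×-isStrictTotalOrder; ×-wellFounded)
open import Data.Product.Relation.Binary.Pointwise.NonDependent
  using (≡×≡⇒≡; ≡⇒≡×≡)
open import Data.Refinement.Base using (Refinement; value)
open import Data.Vec.Base using (Vec; []; _∷_; lookup)
import Data.Vec.Properties as Vec
import Data.Vec.Relation.Binary.Lex.Strict as VecLex
open import Data.Vec.Relation.Binary.Pointwise.Inductive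
  using (Pointwise-≡⇒≡; ≡⇒Pointwise-≡)
import Data.Vec.Relation.Unary.All as VecAll
open import Data.Vec.Relation.Unary.AllPairs using (AllPairs)
open import Function.Base using (_on_; _∘_)
open import Function.Bundles using (_⇔_; mk⇔)
open import Induction.WellFounded using (WellFounded)
open import Level using (0ℓ)
open import Relation.Binary.Core using (Rel)
open import Relation.Binary.Definitions using (Trichotomous; tri<; tri≈; tri>; Decidable)
open import Relation.Binary.Morphism.Structures using (IsOrderIsomorphism)
open import Relation.Binary.PropositionalEquality
  using (_≡_; refl; trans; resp₂; isEquivalence)
open import Relation.Binary.Structures using (IsStrictTotalOrder; IsTotalPreorder)
import Relation.Binary.Construct.Add.Supremum.NonStrict as Supremum
open import Relation.Nullary.Construct.Add.Supremum using (_⁺; ⊤⁺; [_])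
open import Relation.Nullary.Decidable using (Dec; map′; _×-dec_; _⊎-dec_; _→-dec_; ¬?)
open import Relation.Nullary.Negation using (¬_)
open import Relation.Unary using (Pred)
import Relation.Unary as Unary

------------------------------------------------------------------------
-- Ordinals

-- An ordinal, identified with the set of smaller ordinals, is given by
-- that set together with its order.
record Ordinal : Set₁ where
  infix 4 _<_
  field
    Carrier            : Set
    _<_                : Rel Carrier 0ℓ
    isStrictTotalOrder : IsStrictTotalOrder _≡_ _<_
    wellFounded        : WellFounded _<_

-- The ordinal ω^d·b + ω^(d-1)·a_{d-1} + ⋯ + a₀ below ω^d·k is encoded as
-- (b , a_{d-1} ∷ ⋯ ∷ a₀ ∷ []), leading coefficients first, so that the
-- ordinal order is the lexicographic one.
NF : ℕ → ℕ → Set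
NF d k = Fin k × Vec ℕ d

_<ⱽ_ : ∀ {d} → Rel (Vec ℕ d) 0ℓ
_<ⱽ_ = VecLex.Lex-< _≡_ ℕ._<_

_<ᴺ_ : ∀ {d k} → Rel (NF d k) 0ℓ
_<ᴺ_ = ×-Lex _≡_ Fin._<_ _<ⱽ_

private
  -- Replace the equality of a strict total order by propositional equality.
  strictTotal : ∀ {A : Set} {_≈_ _<_ : Rel A 0ℓ} →
                (∀ {x y} → x ≈ y → x ≡ y) → (∀ {x y} → x ≡ y → x ≈ y) →
                IsStrictTotalOrder _≈_ _<_ → IsStrictTotalOrder _≡_ _<_
  strictTotal {_<_ = _<_} to from sto = record
    { isStrictPartialOrder = record
      { isEquivalence = isEquivalence
      ; irrefl        = irrefl ∘ from
      ; trans         = <-trans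
      ; <-resp-≈      = resp₂ _<_
      }
    ; compare = cmp
    }
    where
    open IsStrictTotalOrder sto using (irrefl; compare) renaming (trans to <-trans)
    cmp : Trichotomous _≡_ _<_
    cmp x y with compare x y
    ... | tri< p q r = tri< p (q ∘ from) r
    ... | tri≈ p q r = tri≈ p (to q) r
    ... | tri> p q r = tri> p (q ∘ from) r

<ⱽ-isStrictTotalOrder : ∀ {d} → IsStrictTotalOrder _≡_ (_<ⱽ_ {d})
<ⱽ-isStrictTotalOrder = strictTotal Pointwise-≡⇒≡ ≡⇒Pointwise-≡
  (VecLex.<-isStrictTotalOrder ℕ.<-isStrictTotalOrder)

<ᴺ-isStrictTotalOrder : ∀ {d k} → IsStrictTotalOrder _≡_ (_<ᴺ_ {d} {k})
<ᴺ-isStrictTotalOrder = strictTotal ≡×≡⇒≡ ≡⇒≡×≡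
  (×-isStrictTotalOrder Fin.<-isStrictTotalOrder <ⱽ-isStrictTotalOrder)

<ᴺ-wellFounded : ∀ {d k} → WellFounded (_<ᴺ_ {d} {k})
<ᴺ-wellFounded = ×-wellFounded Fin.<-wellFounded
  (VecLex.<-wellFounded trans (λ { refl p → p }) ℕ.<-wellFounded)

infix 8 ω^_·_

ω^_·_ : ℕ → ℕ → Ordinal
ω^ d · k = record
  { Carrier            = NF d k
  ; _<_                = _<ᴺ_
  ; isStrictTotalOrder = <ᴺ-isStrictTotalOrder
  ; wellFounded        = <ᴺ-wellFounded
  }

------------------------------------------------------------------------
-- The big Ramsey degree T(n, S)

module _ (S : Ordinal) where
  open Ordinal S

  -- An n-element subset is represented by its increasing enumeration; the
  -- monotonicity proof is irrelevant, so equal enumerations are equal subsets.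
  _choose_ : ℕ → Set
  _choose_ n = Refinement (Vec Carrier n) (AllPairs _<_)

  _⊆ˢ_ : ∀ {n} → _choose_ n → Pred Carrier 0ℓ → Set
  s ⊆ˢ S′ = VecAll.All S′ (value s)

  -- S′ ≈ S
  OrderEquivalent : Pred Carrier 0ℓ → Set
  OrderEquivalent S′ = Σ (Σ Carrier S′ → Carrier)
    (IsOrderIsomorphism (_≡_ on proj₁) _≡_ (_<_ on proj₁) _<_)

  -- C = COL(S′ choose n)
  IsImage : ∀ {n c} → (_choose_ n → Fin c) → Pred Carrier 0ℓ → Subset c → Set
  IsImage {n} COL S′ C =
    ∀ i → i Subset.∈ C ⇔ (∃ λ (s : _choose_ n) → s ⊆ˢ S′ × COL s ≡ i)

  Bounds : ℕ → ℕ → Set₁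
  Bounds n t =
    ∀ (c : ℕ) → 1 ℕ.≤ c → (COL : _choose_ n → Fin c) →
    Σ (Pred Carrier 0ℓ) λ S′ →
      OrderEquivalent S′ × (∃ λ C → IsImage COL S′ C × ∣ C ∣ ℕ.≤ t)

ℕ∞ : Set
ℕ∞ = ℕ ⁺

open Supremum ℕ._≤_ public using () renaming (_≤⁺_ to _≤∞_)

-- "T(n, S) = τ": the least t such that Bounds S n t, and ∞ = ⊤⁺ if none.
T[_,_]≡_ : ℕ → Ordinal → ℕ∞ → Set₁
T[ n , S ]≡ [ t ] = Bounds S n t × (∀ t′ → Bounds S n t′ → t ℕ.≤ t′)
T[ n , S ]≡ ⊤⁺    = ∀ t → ¬ Bounds S n t

------------------------------------------------------------------------
-- Coloring rules

-- Indices i and values of 𝒴 are both counted from 0.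
Index : ℕ → ℕ → Set
Index n d = Fin n × Fin d

module Strict {I : Set} (_⪯_ : Rel I 0ℓ) where
  infix 4 _≺_ _≋_

  _≺_ : Rel I 0ℓ
  x ≺ y = x ⪯ y × ¬ (y ⪯ x)

  _≋_ : Rel I 0ℓ
  x ≋ y = x ⪯ y × y ⪯ x

record IsCR {n d k : ℕ} (𝒴 : Fin n → Fin k) (_⪯_ : Rel (Index n d) 0ℓ) : Set where
  open Strict _⪯_
  field
    isTotalPreorder : IsTotalPreorder _≡_ _⪯_
    zeroth-≺        : ∀ i i′ (z : Fin d) → toℕ z ≡ 0 → i Fin.< i′ → (i , z) ≺ (i′ , z)
    𝒴-increasing    : d ≡ 0 → ∀ i i′ → i Fin.< i′ → 𝒴 i Fin.< 𝒴 i′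
    ≋⇒𝒴             : ∀ i i′ j → (i , j) ≋ (i′ , j) → 𝒴 i ≡ 𝒴 i′
    higher-≺        : ∀ i j j′ → j′ Fin.< j → (i , j) ≺ (i , j′)
    ≋⇒level         : ∀ i i′ j j′ → (i , j) ≋ (i′ , j′) → j ≡ j′
    ≋̸-down          : ∀ i i′ j j⁻ → toℕ j ≡ suc (toℕ j⁻) →
                      ¬ (i , j) ≋ (i′ , j) → ¬ (i , j⁻) ≋ (i′ , j⁻)

-- On the finite set Index n d a relation is a Boolean table, so that the
-- pairs (𝒴 , ⪯) form a finite type whose equality is _≡_.
Pair : ℕ → ℕ → ℕ → Set
Pair n d k = Vec (Fin k) n × Vec (Vec (Vec (Vec Bool d) n) d) n

rel : ∀ {n d} → Vec (Vec (Vec (Vec Bool d) n) d) n → Rel (Index n d) 0ℓ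
rel t (i , j) (i′ , j′) = T (lookup (lookup (lookup (lookup t i) j) i′) j′)

CR : ∀ n d k → Pred (Pair n d k) 0ℓ
CR n d k (y , t) = IsCR (lookup y) (rel t)

private
  all-Index? : ∀ {n d} {Q : Pred (Index n d) 0ℓ} → Unary.Decidable Q → Dec (∀ x → Q x)
  all-Index? Q? = map′ (λ f (i , j) → f i j) (λ f i j → f (i , j))
    (all? λ i → all? λ j → Q? (i , j))

isTotalPreorder? : ∀ {n d} {_⪯_ : Rel (Index n d) 0ℓ} →
                   Decidable _⪯_ → Dec (IsTotalPreorder _≡_ _⪯_)
isTotalPreorder? _⪯?_ = map′
  (λ (r , t , o) → record
    { isPreorder = record
      { isEquivalence = isEquivalence
      ; reflexive     = λ { refl → r _ }
      ; trans         = t _ _ _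
      }
    ; total = o
    })
  (λ p → let open IsTotalPreorder p using (total) renaming (refl to ⪯-refl; trans to ⪯-trans) in
    (λ _ → ⪯-refl) , (λ _ _ _ → ⪯-trans) , total)
  (all-Index? (λ x → x ⪯? x) ×-dec
   all-Index? (λ x → all-Index? λ y → all-Index? λ z →
     (x ⪯? y) →-dec ((y ⪯? z) →-dec (x ⪯? z))) ×-dec
   all-Index? (λ x → all-Index? λ y → (x ⪯? y) ⊎-dec (y ⪯? x)))

isCR? : ∀ {n d k} (𝒴 : Fin n → Fin k) {_⪯_ : Rel (Index n d) 0ℓ} →
        Decidable _⪯_ → Dec (IsCR 𝒴 _⪯_)
isCR? {d = d} 𝒴 {_⪯_} _⪯?_ = map′
  (λ (p , a , b , c , e , f , g) → record
    { isTotalPreorder = p ; zeroth-≺ = a ; 𝒴-increasing = b ; ≋⇒𝒴 = c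
    ; higher-≺ = e ; ≋⇒level = f ; ≋̸-down = g })
  (λ cr → let open IsCR cr in
    isTotalPreorder , zeroth-≺ , 𝒴-increasing , ≋⇒𝒴 , higher-≺ , ≋⇒level , ≋̸-down)
  (isTotalPreorder? _⪯?_ ×-dec
   (all? λ i → all? λ i′ → all? λ z →
     (toℕ z ℕ.≟ 0) →-dec ((i Fin.<? i′) →-dec ((i , z) ≺? (i′ , z)))) ×-dec
   ((d ℕ.≟ 0) →-dec (all? λ i → all? λ i′ → (i Fin.<? i′) →-dec (𝒴 i Fin.<? 𝒴 i′))) ×-dec
   (all? λ i → all? λ i′ → all? λ j → ((i , j) ≋? (i′ , j)) →-dec (𝒴 i Fin.≟ 𝒴 i′)) ×-dec
   (all? λ i → all? λ j → all? λ j′ → (j′ Fin.<? j) →-dec ((i , j) ≺? (i , j′))) ×-dec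
   (all? λ i → all? λ i′ → all? λ j → all? λ j′ →
     ((i , j) ≋? (i′ , j′)) →-dec (j Fin.≟ j′)) ×-dec
   (all? λ i → all? λ i′ → all? λ j → all? λ j⁻ →
     (toℕ j ℕ.≟ suc (toℕ j⁻)) →-dec
     (¬? ((i , j) ≋? (i′ , j)) →-dec ¬? ((i , j⁻) ≋? (i′ , j⁻)))))
  where
  open Strict _⪯_
  _≺?_ : Decidable _≺_
  x ≺? y = (x ⪯? y) ×-dec ¬? (y ⪯? x)
  _≋?_ : Decidable _≋_
  x ≋? y = (x ⪯? y) ×-dec (y ⪯? x)

CR? : ∀ n d k → Unary.Decidable (CR n d k)
CR? n d k (y , t) = isCR? (lookup y) (λ _ _ → T? _)

vectors : {A : Set} → List A → ∀ n → List (Vec A n)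
vectors xs zero    = [] ∷ []
vectors xs (suc n) = cartesianProductWith _∷_ xs (vectors xs n)

allTables : ∀ n d → List (Vec (Vec (Vec (Vec Bool d) n) d) n)
allTables n d = vectors (vectors (vectors (vectors (false ∷ true ∷ []) d) n) d) n

allPairs : ∀ n d k → List (Pair n d k)
allPairs n d k = cartesianProduct (vectors (allFin k) n) (allTables n d)

CRs : ∀ n d k → List (Pair n d k)
CRs n d k = filter (CR? n d k) (allPairs n d k)

P[_,ω^_·_] : ℕ → ℕ → ℕ → ℕ
P[ n ,ω^ d · k ] = length (CRs n d k)

-- CRs enumerates the coloring rules, each exactly once.
module _ {A : Set} {xs : List A} where

  ∈-vectors : (∀ x → x ∈ xs) → ∀ {n} (v : Vec A n) → v ∈ vectors xs n
  ∈-vectors h []      = here refl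
  ∈-vectors h (x ∷ v) = ∈-cartesianProductWith⁺ _∷_ (h x) (∈-vectors h v)

  vectors-unique : Unique xs → ∀ n → Unique (vectors xs n)
  vectors-unique u zero    = [] ∷ []
  vectors-unique u (suc n) =
    Unique.cartesianProductWith⁺ _∷_ Vec.∷-injective u (vectors-unique u n)

∈-allPairs : ∀ {n d k} (p : Pair n d k) → p ∈ allPairs n d k
∈-allPairs (y , t) = ∈-cartesianProduct⁺
  (∈-vectors ∈-allFin y)
  (∈-vectors (∈-vectors (∈-vectors (∈-vectors λ { false → here refl ; true → there (here refl) }))) t)

∈-CRs : ∀ {n d k} (p : Pair n d k) → p ∈ CRs n d k ⇔ CR n d k p
∈-CRs {n} {d} {k} p = mk⇔
  (proj₂ ∘ ∈-filter⁻ (CR? n d k) {xs = allPairs n d k})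
  (∈-filter⁺ (CR? n d k) (∈-allPairs p))

CRs-unique : ∀ n d k → Unique (CRs n d k)
CRs-unique n d k = Unique.filter⁺ (CR? n d k) (Unique.cartesianProduct⁺
  (vectors-unique (Unique.allFin⁺ k) n)
  (vectors-unique (vectors-unique (vectors-unique (vectors-unique
    (((λ ()) ∷ []) ∷ [] ∷ []) d) n) d) n))

{-# OPTIONS --safe #-}
-- Match a coloring rule with an n-set by comparing the coefficients of its
-- elements.  An n-set matches at most one rule, since a rule lists the elements
-- in the order of their finite coefficients (or blocks).
--
-- Lower bound: color an n-set by the rule it matches.  Since an increasing
-- self-map f of a well-order satisfies f x ≥ x, a set S′ ≈ ω^d · k meets every
-- block in a tree whose nodes all have infinitely many children with a full
-- subtree.  So any rule can be realized in S′ by choosing the coefficients one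
-- class of the preorder at a time, each larger than all the previous ones.
--
-- Upper bound: a rule and an increasing sequence of numbers determine an n-set,
-- so by Ramsey's theorem there is an infinite H such that the color depends only
-- on the rule as long as the sequence comes from H.  Relabelling each node of the
-- forest ω^d · k by its own element of H, increasingly along paths and among
-- siblings, gives an S′ ≈ ω^d · k all of whose n-sets match a coloring rule.

module Submission where

open import Defs
open import Axiom.ExcludedMiddle using (ExcludedMiddle)
open import Data.Bool.Base using (true; false; T)
open import Data.Bool.Properties using (T?)
open import Data.Empty using (⊥-elim)
open import Data.Fin.Base as Fin using (Fin; zero; suc; toℕ; opposite; fromℕ<)
import Data.Fin.Properties as Fin
open import Data.Fin.Subset as Subset using (Subset; ∣_∣)
import Data.Fin.Subset.Properties as Subset
open import Data.Irrelevant using ([_])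
open import Data.List.Base as List using (List; []; _∷_; length; filter)
open import Data.List.Membership.Propositional as List using ()
import Data.List.Membership.Propositional.Properties as List
import Data.List.Properties as List
open import Data.List.Relation.Unary.All as ListAll using ()
open import Data.List.Relation.Unary.AllPairs using (_∷_)
open import Data.List.Relation.Unary.Any as ListAny using (here; there)
import Data.List.Relation.Unary.Any.Properties as ListAny
open import Data.List.Relation.Unary.Unique.Propositional using (Unique)
open import Data.Nat.Base using (ℕ; zero; suc; _+_; _*_; _∸_; _⊔_; _≤_; _<_; _≤ᵇ_; z≤n; s≤s)
open import Data.Nat.Induction using (<-wellFounded)
import Data.Nat.Properties as ℕ
open import Data.Product.Base using (Σ; ∃; ∃₂; _×_; _,_; proj₁; proj₂)
open import Data.Refinement.Base using (_,_; value)
open import Data.Sum.Base using (_⊎_; inj₁; inj₂; [_,_]′)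
open import Data.Unit.Base using (⊤; tt)
open import Data.Vec.Base as Vec using (Vec; []; _∷_; lookup; tabulate)
open import Data.Vec.Membership.Propositional using (_∈_)
import Data.Vec.Membership.Propositional.Properties as Vec
import Data.Vec.Properties as Vec
open import Data.Vec.Relation.Binary.Lex.Strict as VecLex using (this; next)
open import Data.Vec.Relation.Unary.All as All using (All; []; _∷_)
import Data.Vec.Relation.Unary.All.Properties as All
open import Data.Vec.Relation.Unary.AllPairs as AllPairs using (AllPairs; []; _∷_)
open import Data.Vec.Relation.Unary.Any using (here; there)
import Data.Vec.Relation.Unary.Any.Properties as VecAny
open import Function.Base using (_∘_; id; _on_)
open import Function.Bundles using (_⇔_; mk⇔; Equivalence)
open import Induction.WellFounded using (Acc; acc; WellFounded)
open import Level using (0ℓ)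
open import Relation.Binary.Core using (Rel)
open import Relation.Binary.Definitions using (Asymmetric; Transitive; tri<; tri≈; tri>; Decidable)
open import Relation.Binary.Morphism.Structures using (IsOrderIsomorphism)
open import Relation.Binary.PropositionalEquality
  using (_≡_; _≢_; refl; isEquivalence; sym; trans; cong; cong₂; subst; subst₂; module ≡-Reasoning)
open import Relation.Binary.Structures using (IsStrictTotalOrder; IsTotalPreorder)
open import Relation.Nullary.Construct.Add.Supremum using ([_]; ⊤⁺)
open import Relation.Nullary.Decidable
  using (Dec; yes; no; does; dec-true; recompute; ¬?; decidable-stable)
open import Relation.Nullary.Negation using (¬_; contradiction)
open import Relation.Binary.Construct.Add.Supremum.NonStrict _≤_ using ([_]; _≤⊤⁺)

-- Enumerations

module _ {A : Set} where

  infix 4 _≐_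

  _≐_ : ∀ {m n} → Vec A m → Vec A n → Set
  xs ≐ ys = (∀ {z} → z ∈ xs → z ∈ ys) × (∀ {z} → z ∈ ys → z ∈ xs)

  ≐-sym : ∀ {m n} {xs : Vec A m} {ys : Vec A n} → xs ≐ ys → ys ≐ xs
  ≐-sym (f , g) = g , f

  ≐-trans : ∀ {l m n} {xs : Vec A l} {ys : Vec A m} {zs : Vec A n} →
            xs ≐ ys → ys ≐ zs → xs ≐ zs
  ≐-trans (f , g) (f′ , g′) = f′ ∘ f , g ∘ g′

  All-tabulate : ∀ {P : A → Set} {n} {xs : Vec A n} → (∀ {z} → z ∈ xs → P z) → All P xs
  All-tabulate h = All.lookup⁻ λ i → h (Vec.∈-lookup i _)

  AllPairs-lookup : ∀ {R : Rel A 0ℓ} {n} {xs : Vec A n} → AllPairs R xs →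
                    ∀ {i j} → i Fin.< j → R (lookup xs i) (lookup xs j)
  AllPairs-lookup (Rx ∷ Rxs) {zero}  {suc j} _         = All.lookup⁺ Rx j
  AllPairs-lookup (Rx ∷ Rxs) {suc i} {suc j} (s≤s i<j) = AllPairs-lookup Rxs i<j

  AllPairs-tabulate : ∀ {R : Rel A 0ℓ} {n} {xs : Vec A n} →
                      (∀ {i j} → i Fin.< j → R (lookup xs i) (lookup xs j)) → AllPairs R xs
  AllPairs-tabulate {xs = []}     h = []
  AllPairs-tabulate {xs = x ∷ xs} h =
    All.lookup⁻ (λ j → h {zero} {suc j} (s≤s z≤n)) ∷ AllPairs-tabulate (λ i<j → h (s≤s i<j))

  module _ {R : Rel A 0ℓ} (asym : Asymmetric R) where

    -- If the heads differed, each would lie in the other tail and hence above the other head,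
    -- against asymmetry. For the same reason the common head occurs in neither tail, so the tails
    -- have the same members.
    sorted-unique : ∀ {n} {xs ys : Vec A n} →
                    AllPairs R xs → AllPairs R ys → xs ≐ ys → xs ≡ ys
    sorted-unique [] [] _ = refl
    sorted-unique {xs = x ∷ xs} {y ∷ ys} (Rx ∷ Rxs) (Ry ∷ Rys) (f , g) =
      cong₂ _∷_ x≡y (sorted-unique Rxs Rys (f′ , g′))
      where
      x≡y : x ≡ y
      x≡y with f (here refl) | g (here refl)
      ... | here eq | _       = eq
      ... | there _ | here eq = sym eq
      ... | there p | there q = contradiction (All.lookup Rx q) (asym (All.lookup Ry p))
      f′ : ∀ {z} → z ∈ xs → z ∈ ys
      f′ p with f (there p)
      ... | there q   = q
      ... | here refl = ⊥-elim (asym r r)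
        where r = subst (λ u → R u _) x≡y (All.lookup Rx p)
      g′ : ∀ {z} → z ∈ ys → z ∈ xs
      g′ q with g (there q)
      ... | there p   = p
      ... | here refl = ⊥-elim (asym r r)
        where r = subst (λ u → R u _) (sym x≡y) (All.lookup Ry q)

  module _ {R : Rel A 0ℓ} (R-trans : Transitive R) (compare : ∀ {x y} → x ≢ y → R x y ⊎ R y x) where

    insert : ∀ {n} y {xs : Vec A n} → All (y ≢_) xs → AllPairs R xs →
             ∃ λ (zs : Vec A (suc n)) → AllPairs R zs × zs ≐ (y ∷ xs)
    insert y []                         []         = y ∷ [] , [] ∷ [] , id , id
    insert y {x ∷ xs} (y≢x ∷ y≢xs) (Rx ∷ Rxs) with compare y≢x
    ... | inj₁ Ryx = y ∷ x ∷ xs , (Ryx ∷ All.map (R-trans Ryx) Rx) ∷ Rx ∷ Rxs , id , id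
    ... | inj₂ Rxy with insert y y≢xs Rxs
    ...   | zs , Rzs , f , g =
      x ∷ zs , All-tabulate Rxz ∷ Rzs , f′ , g′
      where
      Rxz : ∀ {z} → z ∈ zs → R x z
      Rxz z∈ with f z∈
      ... | here refl = Rxy
      ... | there z∈′ = All.lookup Rx z∈′
      f′ : ∀ {z} → z ∈ x ∷ zs → z ∈ y ∷ x ∷ xs
      f′ (here eq)  = there (here eq)
      f′ (there z∈) with f z∈
      ... | here eq   = here eq
      ... | there z∈′ = there (there z∈′)
      g′ : ∀ {z} → z ∈ y ∷ x ∷ xs → z ∈ x ∷ zs
      g′ (here eq)          = there (g (here eq))
      g′ (there (here eq))  = here eq
      g′ (there (there z∈)) = there (g (there z∈))

    -- Serves two orders: `_<ᴺ_`, which turns a tuple into an n-set, and the order of leaf codes,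
    -- which lists an n-set the way a rule does.
    sort : ∀ {n} {xs : Vec A n} → AllPairs _≢_ xs →
           ∃ λ (zs : Vec A n) → AllPairs R zs × zs ≐ xs
    sort []                  = [] , [] , id , id
    sort {xs = x ∷ xs} (x≢ ∷ ≢xs) with sort ≢xs
    ... | zs , Rzs , f , g with insert x (All-tabulate (All.lookup x≢ ∘ f)) Rzs
    ...   | ws , Rws , f′ , g′ = ws , Rws , push ∘ f′ , g′ ∘ push′
      where
      push : ∀ {z} → z ∈ x ∷ zs → z ∈ x ∷ xs
      push (here eq)  = here eq
      push (there z∈) = there (f z∈)
      push′ : ∀ {z} → z ∈ x ∷ xs → z ∈ x ∷ zs
      push′ (here eq)  = here eq
      push′ (there z∈) = there (g z∈)

-- Infinite Ramsey theory

StrictlyIncreasing : (ℕ → ℕ) → Set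
StrictlyIncreasing f = ∀ {m n} → m < n → f m < f n

module _ {f : ℕ → ℕ} (f-mono : StrictlyIncreasing f) where

  increasing-≤ : ∀ {m n} → m ≤ n → f m ≤ f n
  increasing-≤ m≤n with ℕ.m≤n⇒m<n∨m≡n m≤n
  ... | inj₁ m<n  = ℕ.<⇒≤ (f-mono m<n)
  ... | inj₂ refl = ℕ.≤-refl

  increasing-cancel-< : ∀ {m n} → f m < f n → m < n
  increasing-cancel-< fm<fn = ℕ.≰⇒> λ n≤m → ℕ.<⇒≱ fm<fn (increasing-≤ n≤m)

  increasing-cancel-≤ : ∀ {m n} → f m ≤ f n → m ≤ n
  increasing-cancel-≤ fm≤fn = ℕ.≮⇒≥ λ n<m → ℕ.<⇒≱ (f-mono n<m) fm≤fn

  increasing-injective : ∀ {m n} → f m ≡ f n → m ≡ n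
  increasing-injective eq = ℕ.≤-antisym
    (increasing-cancel-≤ (ℕ.≤-reflexive eq)) (increasing-cancel-≤ (ℕ.≤-reflexive (sym eq)))

steps⇒increasing : ∀ {f : ℕ → ℕ} → (∀ n → f n < f (suc n)) → StrictlyIncreasing f
steps⇒increasing step {m} {suc n} (s≤s m≤n) with ℕ.m≤n⇒m<n∨m≡n m≤n
... | inj₁ m<n  = ℕ.<-trans (steps⇒increasing step m<n) (step n)
... | inj₂ refl = step n

Infinite : (ℕ → Set) → Set
Infinite H = ∀ m → ∃ λ y → m < y × H y

enumerate : ∀ {H} → Infinite H → ∃ λ h → StrictlyIncreasing h × ∀ i → H (h i)
enumerate {H} inf = h , steps⇒increasing (λ n → proj₁ (proj₂ (inf (h n)))) , h∈H
  where
  h : ℕ → ℕ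
  h zero    = proj₁ (inf 0)
  h (suc n) = proj₁ (inf (h n))
  h∈H : ∀ i → H (h i)
  h∈H zero    = proj₂ (proj₂ (inf 0))
  h∈H (suc i) = proj₂ (proj₂ (inf (h i)))

Fin-bounded : ∀ {c} (f : Fin c → ℕ) → ∃ λ M → ∀ q → f q ≤ M
Fin-bounded {zero}  f = 0 , λ ()
Fin-bounded {suc c} f with Fin-bounded (f ∘ suc)
... | M , bound = f zero ⊔ M , λ
  { zero    → ℕ.m≤m⊔n (f zero) M
  ; (suc q) → ℕ.m≤n⇒m≤o⊔n (f zero) (bound q)
  }

module Ramsey (em : ExcludedMiddle 0ℓ) where

  ¬∀⇒∃¬ : {A : Set} {P : A → Set} → ¬ (∀ x → P x) → ∃ λ x → ¬ P x
  ¬∀⇒∃¬ {P = P} ¬∀ with em {∃ λ x → ¬ P x}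
  ... | yes p = p
  ... | no ¬∃ = contradiction (λ x → decidable-stable em λ ¬Px → ¬∃ (x , ¬Px)) ¬∀

  -- Otherwise each value stops occurring from some point on; past the maximum `M` of these points
  -- no value is left for `e (suc M)`.
  pigeonhole : ∀ {c} (e : ℕ → Fin c) → ∃ λ q → Infinite (λ i → e i ≡ q)
  pigeonhole e with Fin.any? (λ q → em {Infinite (λ i → e i ≡ q)})
  ... | yes p = p
  ... | no ¬∃ = contradiction (suc M , s≤s (M-bounds _) , refl) (proj₂ (last (e (suc M))))
    where
    last : ∀ q → ∃ λ m → ¬ ∃ λ i → m < i × e i ≡ q
    last q = ¬∀⇒∃¬ (¬∃ ∘ (q ,_))
    M = proj₁ (Fin-bounded (proj₁ ∘ last))
    M-bounds = proj₂ (Fin-bounded (proj₁ ∘ last))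

  -- Induction on `N`. Stage `i` picks an element `a i` of the current set and shrinks the set above
  -- it until the color of `a i ∷ Y` is a constant `e i` for increasing `Y`. The picks at the stages
  -- where `e i` is a value taken infinitely often form the homogeneous set.
  ramsey : ∀ N {c} (χ : Vec ℕ N → Fin c) {H} → Infinite H →
           Σ (ℕ → Set) λ H′ → Infinite H′ × (∀ {y} → H′ y → H y) ×
           ∃ λ e → ∀ {Y} → AllPairs _<_ Y → All H′ Y → χ Y ≡ e
  ramsey zero    χ {H} H-inf = H , H-inf , id , χ [] , λ { [] [] → refl }
  ramsey (suc N) {c} χ {H} H-inf = H′ ,
    H′-inf , (λ { (i , refl , _) → within {0} {i} z≤n (a∈ i) }) , q , homogeneous
    where
    State : Set₁
    State = Σ (ℕ → Set) Infinite

    pick : State → ℕ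
    pick (_ , inf) = proj₁ (inf 0)

    refine : ∀ S → _
    refine S@(G , inf) = ramsey N (λ Y → χ (pick S ∷ Y)) {λ y → G y × pick S < y}
      λ m → let y , m⊔a<y , y∈G = inf (m ⊔ pick S) in
        y , ℕ.m⊔n<o⇒m<o m (pick S) m⊔a<y , y∈G , ℕ.m⊔n<o⇒n<o m (pick S) m⊔a<y

    step : State → State
    step S = proj₁ (refine S) , proj₁ (proj₂ (refine S))

    state : ℕ → State
    state zero    = H , H-inf
    state (suc i) = step (state i)

    G : ℕ → ℕ → Set
    G i = proj₁ (state i)

    a : ℕ → ℕ
    a i = pick (state i)

    e : ℕ → Fin c
    e i = proj₁ (proj₂ (proj₂ (proj₂ (refine (state i)))))

    a∈ : ∀ i → G i (a i)
    a∈ i = proj₂ (proj₂ (proj₂ (state i) 0))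

    shrink : ∀ i {y} → G (suc i) y → G i y × a i < y
    shrink i = proj₁ (proj₂ (proj₂ (refine (state i))))

    within : ∀ {i j y} → i ≤ j → G j y → G i y
    within {i} {zero}  z≤n y∈ = y∈
    within {i} {suc j} i≤1+j y∈ with ℕ.m≤n⇒m<n∨m≡n i≤1+j
    ... | inj₂ refl      = y∈
    ... | inj₁ (s≤s i≤j) = within i≤j (proj₁ (shrink j y∈))

    a-increasing : StrictlyIncreasing a
    a-increasing = steps⇒increasing λ i → proj₂ (shrink i (a∈ (suc i)))

    i<ai : ∀ i → i < a i
    i<ai zero    = proj₁ (proj₂ (H-inf 0))
    i<ai (suc i) = ℕ.≤-<-trans (i<ai i) (a-increasing {i} ℕ.≤-refl)

    q     = proj₁ (pigeonhole e)
    q-inf = proj₂ (pigeonhole e)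

    H′ : ℕ → Set
    H′ y = ∃ λ i → a i ≡ y × e i ≡ q

    H′-inf : Infinite H′
    H′-inf m = let i , m<i , ei≡q = q-inf m in a i , ℕ.<-trans m<i (i<ai i) , i , refl , ei≡q

    homogeneous : ∀ {Y} → AllPairs _<_ Y → All H′ Y → χ Y ≡ q
    homogeneous (y< ∷ Y↗) ((i , refl , ei≡q) ∷ Y⊆) = trans
      (proj₂ (proj₂ (proj₂ (proj₂ (refine (state i))))) Y↗
        -- Every later entry is some `a j` with `j > i`, so it survives in the set that stage `i`
        -- left.
        (All.map (λ { (ai<y , j , refl , _) →
            within {suc i} {j} (increasing-cancel-< a-increasing {i} {j} ai<y) (a∈ j) })
          (All.zip (y< , Y⊆))))
      ei≡q

  opaque

    ramsey-family : ∀ N {c} P (χ : Fin P → Vec ℕ N → Fin c) {H} → Infinite H →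
                    Σ (ℕ → Set) λ H′ → Infinite H′ × (∀ {y} → H′ y → H y) ×
                    ∃ λ (e : Fin P → Fin c) → ∀ q {Y} → AllPairs _<_ Y → All H′ Y → χ q Y ≡ e q
    ramsey-family N zero    χ {H} inf = H , inf , id , (λ ()) , λ ()
    ramsey-family N (suc P) χ {H} inf =
      let H₁ , inf₁ , H₁⊆H , e₀ , hom₀ = ramsey N (χ zero) inf
          H₂ , inf₂ , H₂⊆H₁ , e , hom  = ramsey-family N P (χ ∘ suc) inf₁
      in H₂ , inf₂ , H₁⊆H ∘ H₂⊆H₁ , (λ { zero → e₀ ; (suc q) → e q }) , λ
        { zero    Y↗ Y⊆ → hom₀ Y↗ (All.map H₂⊆H₁ Y⊆)
        ; (suc q) Y↗ Y⊆ → hom q Y↗ Y⊆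
        }

    -- Only the first `N` values of `X` enter. Taking `X` on all of ℕ lets the interpolation of
    -- ranks supply it directly.
    homogeneous-sequence : ∀ N {c} P (χ : Fin P → Vec ℕ N → Fin c) →
      ∃ λ h → StrictlyIncreasing h × ∃ λ (e : Fin P → Fin c) →
      ∀ q {X} → StrictlyIncreasing X → χ q (tabulate (h ∘ X ∘ toℕ)) ≡ e q
    homogeneous-sequence N P χ =
      let H , H-inf , _ , e , hom = ramsey-family N P χ {λ _ → ⊤} λ m → suc m , ℕ.≤-refl , tt
          h , h↗ , h∈H = enumerate H-inf
      in h , h↗ , e , λ q {X} X↗ → hom q
        (AllPairs-tabulate λ {r} {r′} r<r′ → subst₂ _<_
          (sym (Vec.lookup∘tabulate (h ∘ X ∘ toℕ) r)) (sym (Vec.lookup∘tabulate (h ∘ X ∘ toℕ) r′))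
          (h↗ (X↗ r<r′)))
        (All.tabulate⁺ λ r → h∈H (X (toℕ r)))

-- Rank functions of finite total preorders

module _ {A : Set} {P Q : A → Set} (P? : ∀ x → Dec (P x)) (Q? : ∀ x → Dec (Q x))
         (P⇒Q : ∀ {x} → P x → Q x) where

  length-filter-mono : ∀ xs → length (filter P? xs) ≤ length (filter Q? xs)
  length-filter-mono [] = z≤n
  length-filter-mono (x ∷ xs) with P? x | Q? x
  ... | yes _  | yes _ = s≤s (length-filter-mono xs)
  ... | yes Px | no ¬Q = contradiction (P⇒Q Px) ¬Q
  ... | no _   | yes _ = ℕ.m≤n⇒m≤1+n (length-filter-mono xs)
  ... | no _   | no _  = length-filter-mono xs

  length-filter-mono-< : ∀ {y xs} → y List.∈ xs → ¬ P y → Q y →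
                         length (filter P? xs) < length (filter Q? xs)
  length-filter-mono-< {xs = x ∷ xs} (here refl) ¬Py Qy with P? x | Q? x
  ... | yes Px | _     = contradiction Px ¬Py
  ... | no _   | yes _ = s≤s (length-filter-mono xs)
  ... | no _   | no ¬Q = contradiction Qy ¬Q
  length-filter-mono-< {xs = x ∷ xs} (there y∈) ¬Py Qy with P? x | Q? x
  ... | yes _  | yes _ = s≤s (length-filter-mono-< y∈ ¬Py Qy)
  ... | yes Px | no ¬Q = contradiction (P⇒Q Px) ¬Q
  ... | no _   | yes _ = ℕ.m≤n⇒m≤1+n (length-filter-mono-< y∈ ¬Py Qy)
  ... | no _   | no _  = length-filter-mono-< y∈ ¬Py Qy

module Rank {A : Set} {_⪯_ : Rel A 0ℓ} (_⪯?_ : Decidable _⪯_)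
            (isTotalPreorder : IsTotalPreorder _≡_ _⪯_)
            (elements : List A) (complete : ∀ a → a List.∈ elements) where

  open IsTotalPreorder isTotalPreorder using ()
    renaming (refl to ⪯-refl; trans to ⪯-trans)

  bound : ℕ
  bound = suc (length elements)

  -- By totality `a ⪯ c` fails exactly when `c` is strictly below `a`. Equivalent elements share a
  -- rank, and some numbers below `bound` may be no rank at all.
  rank : A → ℕ
  rank a = length (filter (λ c → ¬? (a ⪯? c)) elements)

  rank<bound : ∀ a → rank a < bound
  rank<bound a = s≤s (List.length-filter _ elements)

  rank-mono : ∀ {a b} → a ⪯ b → rank a ≤ rank b
  rank-mono a⪯b = length-filter-mono _ _ (λ a⋠c b⪯c → a⋠c (⪯-trans a⪯b b⪯c)) elements

  rank-mono-< : ∀ {a b} → a ⪯ b → ¬ b ⪯ a → rank a < rank b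
  rank-mono-< {a} a⪯b b⋠a = length-filter-mono-< _ _ (λ a⋠c b⪯c → a⋠c (⪯-trans a⪯b b⪯c))
    (complete a) (λ a⋠a → a⋠a ⪯-refl) b⋠a

  rank-cancel : ∀ {a b} → rank a ≤ rank b → a ⪯ b
  rank-cancel {a} {b} ra≤rb with a ⪯? b
  ... | yes a⪯b = a⪯b
  ... | no a⋠b  = contradiction ra≤rb (ℕ.<⇒≱ (rank-mono-< b⪯a a⋠b))
    where
    b⪯a : b ⪯ a
    b⪯a with IsTotalPreorder.total isTotalPreorder a b
    ... | inj₁ p = contradiction p a⋠b
    ... | inj₂ q = q

  -- The values of f are multiples of the bound, so the ranks that are not taken
  -- fit into the gaps.
  module _ (c : A → ℕ) (c-mono : ∀ {a b} → a ⪯ b → c a ≤ c b)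
           (c-cancel : ∀ {a b} → c a ≤ c b → a ⪯ b) where

    f : A → ℕ
    f a = suc (c a) * bound

    -- The maximum of the identity and of lines of slope one, where the line of `a` starts at
    -- `rank a` with height `f a`. A maximum of strictly increasing functions is strictly
    -- increasing.
    interpolate : List A → ℕ → ℕ
    interpolate []       r = r
    interpolate (a ∷ as) r with rank a ℕ.≤? r
    ... | yes _ = (f a + (r ∸ rank a)) ⊔ interpolate as r
    ... | no _  = interpolate as r

    interpolate-step : ∀ as r → interpolate as r < interpolate as (suc r)
    interpolate-step []       r = ℕ.≤-refl
    interpolate-step (a ∷ as) r with rank a ℕ.≤? r | rank a ℕ.≤? suc r
    ... | yes p | yes _ = ℕ.⊔-mono-<
      (ℕ.+-monoʳ-< (f a) (ℕ.≤-reflexive (sym (ℕ.+-∸-assoc 1 p)))) (interpolate-step as r)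
    ... | yes p | no ¬p = contradiction (ℕ.m≤n⇒m≤1+n p) ¬p
    ... | no _  | yes _ = ℕ.m≤n⇒m≤o⊔n _ (interpolate-step as r)
    ... | no _  | no _  = interpolate-step as r

    -- A line started strictly below `b` climbs by less than `bound` on its way, whereas `f` gains
    -- at least `bound`. A line started at an equivalent of `b` has not climbed yet.
    interpolate-≤ : ∀ as b → interpolate as (rank b) ≤ f b
    interpolate-≤ []       b = ℕ.≤-trans (ℕ.<⇒≤ (rank<bound b)) (ℕ.m≤m+n bound _)
    interpolate-≤ (a ∷ as) b with rank a ℕ.≤? rank b
    ... | no _  = interpolate-≤ as b
    ... | yes p = ℕ.⊔-lub gap (interpolate-≤ as b)
      where
      gap : f a + (rank b ∸ rank a) ≤ f b
      gap with b ⪯? a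
      ... | yes b⪯a = ℕ.≤-trans
        (ℕ.≤-reflexive (trans (cong (f a +_) (ℕ.m≤n⇒m∸n≡0 (rank-mono b⪯a))) (ℕ.+-identityʳ (f a))))
        (ℕ.*-monoˡ-≤ bound (s≤s (c-mono (rank-cancel p))))
      ... | no b⋠a  = begin
        f a + (rank b ∸ rank a) ≤⟨ ℕ.+-monoʳ-≤ (f a) (ℕ.m∸n≤m (rank b) (rank a)) ⟩
        f a + rank b            ≤⟨ ℕ.+-monoʳ-≤ (f a) (ℕ.<⇒≤ (rank<bound b)) ⟩
        f a + bound             ≡⟨ ℕ.+-comm (f a) bound ⟩
        suc (suc (c a)) * bound ≤⟨ ℕ.*-monoˡ-≤ bound (s≤s (ℕ.≰⇒> (b⋠a ∘ c-cancel))) ⟩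
        f b                     ∎
        where open ℕ.≤-Reasoning

    interpolate-≥ : ∀ {as b} → b List.∈ as → f b ≤ interpolate as (rank b)
    interpolate-≥ {a ∷ as} {b} b∈ with rank a ℕ.≤? rank b
    interpolate-≥ {a ∷ as} (here refl) | yes _ = ℕ.m≤n⇒m≤n⊔o (interpolate as (rank a)) (ℕ.m≤m+n (f a) _)
    interpolate-≥ {a ∷ as} (here refl) | no ¬p = contradiction ℕ.≤-refl ¬p
    interpolate-≥ {a ∷ as} (there b∈)  | yes _ = ℕ.m≤n⇒m≤o⊔n _ (interpolate-≥ b∈)
    interpolate-≥ {a ∷ as} (there b∈)  | no _  = interpolate-≥ b∈

    opaque

      interpolation : ∃ λ X → StrictlyIncreasing X × ∀ a → X (rank a) ≡ f a
      interpolation = interpolate elements , steps⇒increasing (interpolate-step elements) ,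
        λ a → ℕ.≤-antisym (interpolate-≤ elements a) (interpolate-≥ (complete a))

-- Coloring rules matched by tuples and by subsets

module _ {n d k : ℕ} where

  -- NF lists the coefficients from the leading one down, CRs index them by level.
  coef : Vec (NF d k) n → Index n d → ℕ
  coef x (i , j) = lookup (proj₂ (lookup x i)) (opposite j)

  record Matches (𝒴 : Fin n → Fin k) (_⪯_ : Rel (Index n d) 0ℓ) (x : Vec (NF d k) n) : Set where
    field
      block : ∀ i → proj₁ (lookup x i) ≡ 𝒴 i
      ⪯⇒≤   : ∀ {a b} → a ⪯ b → coef x a ≤ coef x b
      ≤⇒⪯   : ∀ {a b} → coef x a ≤ coef x b → a ⪯ b

  MatchesPair : Pair n d k → Vec (NF d k) n → Set
  MatchesPair (y , t) = Matches (lookup y) (rel t)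

lookup-extensional : ∀ {A : Set} {n} {u v : Vec A n} → (∀ i → lookup u i ≡ lookup v i) → u ≡ v
lookup-extensional {u = u} {v} eq =
  trans (sym (Vec.tabulate∘lookup u)) (trans (Vec.tabulate-cong eq) (Vec.tabulate∘lookup v))

module _ {n d k : ℕ} where

  assemble : (Fin n → Fin k) → (Index n d → ℕ) → Vec (NF d k) n
  assemble 𝒴 f = tabulate λ i → 𝒴 i , tabulate λ l → f (i , opposite l)

  module _ (𝒴 : Fin n → Fin k) (f : Index n d → ℕ) where

    private
      assemble-lookup : ∀ i → lookup (assemble 𝒴 f) i ≡ (𝒴 i , tabulate λ l → f (i , opposite l))
      assemble-lookup = Vec.lookup∘tabulate _

    assemble-block : ∀ i → proj₁ (lookup (assemble 𝒴 f) i) ≡ 𝒴 i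
    assemble-block i = cong proj₁ (assemble-lookup i)

    assemble-coef : ∀ a → coef (assemble 𝒴 f) a ≡ f a
    assemble-coef (i , j) = begin
      coef (assemble 𝒴 f) (i , j)
        ≡⟨ cong (λ y → lookup (proj₂ y) (opposite j)) (assemble-lookup i) ⟩
      lookup (tabulate λ l → f (i , opposite l)) (opposite j)
        ≡⟨ Vec.lookup∘tabulate (λ l → f (i , opposite l)) (opposite j) ⟩
      f (i , opposite (opposite j))
        ≡⟨ cong (λ j → f (i , j)) (Fin.opposite-involutive j) ⟩
      f (i , j) ∎
      where open ≡-Reasoning

  tuple-extensional : {x x′ : Vec (NF d k) n} → (∀ i → proj₁ (lookup x i) ≡ proj₁ (lookup x′ i)) →
                      (∀ a → coef x a ≡ coef x′ a) → x ≡ x′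
  tuple-extensional {x} {x′} block≡ coef≡ = lookup-extensional λ i →
    cong₂ _,_ (block≡ i) (lookup-extensional λ l → subst
      (λ l → lookup (proj₂ (lookup x i)) l ≡ lookup (proj₂ (lookup x′ i)) l)
      (Fin.opposite-involutive l) (coef≡ (i , opposite l)))

T-injective : ∀ {a b} → (T a → T b) → (T b → T a) → a ≡ b
T-injective {false} {false} f g = refl
T-injective {false} {true}  f g = ⊥-elim (g _)
T-injective {true}  {false} f g = ⊥-elim (f _)
T-injective {true}  {true}  f g = refl

matches-unique : ∀ {n d k} {p p′ : Pair n d k} {x} → MatchesPair p x → MatchesPair p′ x → p ≡ p′
matches-unique m m′ = cong₂ _,_
  (lookup-extensional λ i → trans (sym (M.block i)) (M′.block i))
  (lookup-extensional λ i → lookup-extensional λ j → lookup-extensional λ i′ → lookup-extensional λ j′ →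
    T-injective (M′.≤⇒⪯ ∘ M.⪯⇒≤) (M.≤⇒⪯ {i , j} {i′ , j′} ∘ M′.⪯⇒≤))
  where
  module M  = Matches m
  module M′ = Matches m′

-- The only pair that `x` can match; whether it is a coloring rule depends on `x`.
pattern-of : ∀ {n d k} → Vec (NF d k) n → Pair n d k
pattern-of x = Vec.map proj₁ x ,
  tabulate λ i → tabulate λ j → tabulate λ i′ → tabulate λ j′ → coef x (i , j) ≤ᵇ coef x (i′ , j′)

matches-pattern : ∀ {n d k} (x : Vec (NF d k) n) → MatchesPair (pattern-of x) x
matches-pattern {n} {d} x = record
  { block = λ i → sym (Vec.lookup-map i proj₁ x)
  ; ⪯⇒≤   = λ {a} {b} a⪯b → ℕ.≤ᵇ⇒≤ _ _ (subst T (entry a b) a⪯b)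
  ; ≤⇒⪯   = λ {a} {b} a≤b → subst T (sym (entry a b)) (ℕ.≤⇒≤ᵇ a≤b)
  }
  where
  t = proj₂ (pattern-of x)
  cell = λ i j i′ j′ → coef x (i , j) ≤ᵇ coef x (i′ , j′)
  entry : ∀ a b → lookup (lookup (lookup (lookup t (proj₁ a)) (proj₂ a)) (proj₁ b)) (proj₂ b)
                  ≡ (coef x a ≤ᵇ coef x b)
  entry (i , j) (i′ , j′)
    rewrite Vec.lookup∘tabulate (λ i → tabulate λ j → tabulate λ i′ → tabulate λ j′ → cell i j i′ j′) i
          | Vec.lookup∘tabulate (λ j → tabulate λ i′ → tabulate λ j′ → cell i j i′ j′) j
          | Vec.lookup∘tabulate (λ i′ → tabulate λ j′ → cell i j i′ j′) i′
    = Vec.lookup∘tabulate (λ j′ → cell i j i′ j′) j′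

-- A coloring rule lists the elements of a set in the order of their finite
-- coefficients (of their blocks if d = 0), not in the order of the ordinal.
key : ∀ {d k} → NF d k → ℕ
key {zero}  (b , _) = toℕ b
key {suc d} (_ , v) = lookup v (opposite zero)

key-increasing : ∀ {n d k} {𝒴 : Fin n → Fin k} {_⪯_ : Rel (Index n d) 0ℓ} {x} →
                 IsCR 𝒴 _⪯_ → Matches 𝒴 _⪯_ x → AllPairs (_<_ on key) x
key-increasing {d = zero} cr m = AllPairs-tabulate λ {i} {j} i<j →
  subst₂ Fin._<_ (sym (block i)) (sym (block j)) (𝒴-increasing refl i j i<j)
  where open IsCR cr; open Matches m
key-increasing {d = suc d} cr m = AllPairs-tabulate λ {i} {j} i<j →
  ℕ.≰⇒> (proj₂ (zeroth-≺ i j zero refl i<j) ∘ ≤⇒⪯)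
  where open IsCR cr; open Matches m

-- Subsets of size n and the rules they realize

module <ᴺ {d k} = IsStrictTotalOrder (<ᴺ-isStrictTotalOrder {d} {k})

module _ {n d k : ℕ} where

  -- The set is enumerated in the order of the ordinal and `x` in the order of the rule, so only
  -- their members are compared.
  Realizes : Pair n d k → (ω^ d · k) choose n → Set
  Realizes p s = ∃ λ x → MatchesPair p x × value s ≐ x

  -- Both tuples list `s` by increasing key, so they coincide, and a tuple determines the pair it
  -- matches.
  realizes-unique : ∀ {p p′ s} → CR n d k p → CR n d k p′ → Realizes p s → Realizes p′ s → p ≡ p′
  realizes-unique {p} cr cr′ (x , m , s≐x) (x′ , m′ , s≐x′) =
    matches-unique (subst (MatchesPair p) x≡x′ m) m′
    where
    x≡x′ : x ≡ x′
    x≡x′ = sorted-unique (λ {a} {b} → ℕ.<-asym {key a} {key b})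
      (key-increasing cr m) (key-increasing cr′ m′) (≐-trans (≐-sym s≐x) s≐x′)

  -- The monotonicity proof is irrelevant in `s`; deciding the proposition makes it usable again.
  choose-sorted : ExcludedMiddle 0ℓ → (s : (ω^ d · k) choose n) → AllPairs _<ᴺ_ (value s)
  choose-sorted em (_ , [ v↗ ]) = recompute em v↗

  choose-unique : ExcludedMiddle 0ℓ → ∀ {s s′ : (ω^ d · k) choose n} → value s ≐ value s′ → s ≡ s′
  choose-unique em {s} {s′} s≐s′ =
    value-injective (sorted-unique <ᴺ.asym (choose-sorted em s) (choose-sorted em s′) s≐s′)
    where
    value-injective : ∀ {s s′ : (ω^ d · k) choose n} → value s ≡ value s′ → s ≡ s′
    value-injective refl = refl

  choose-exists : {x : Vec (NF d k) n} → AllPairs _≢_ x → ∃ λ (s : (ω^ d · k) choose n) → value s ≐ x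
  choose-exists x≢ with sort <ᴺ.trans ≢⇒<> x≢
    where
    ≢⇒<> : ∀ {x y : NF d k} → x ≢ y → x <ᴺ y ⊎ y <ᴺ x
    ≢⇒<> {x} {y} x≢y with <ᴺ.compare x y
    ... | tri< x<y _ _   = inj₁ x<y
    ... | tri≈ _ x≡y _   = contradiction x≡y x≢y
    ... | tri> _ _ y<x   = inj₂ y<x
  ... | v , v↗ , v≐x = (v , [ v↗ ]) , v≐x

  key-increasing⇒distinct : {x : Vec (NF d k) n} → AllPairs (_<_ on key) x → AllPairs _≢_ x
  key-increasing⇒distinct = AllPairs.map λ { x<x refl → ℕ.<-irrefl refl x<x }

-- A tree of codes

opaque

  -- The injection 2^x * (2 * y + 1). It exceeds `x` and increases in `y`, which makes codes
  -- increase along paths and among siblings.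
  pair : ℕ → ℕ → ℕ
  pair zero    y = suc (2 * y)
  pair (suc x) y = 2 * pair x y

  pair-increasing : ∀ x → StrictlyIncreasing (pair x)
  pair-increasing zero    y<y′ = s≤s (ℕ.*-monoʳ-< 2 y<y′)
  pair-increasing (suc x) y<y′ = ℕ.*-monoʳ-< 2 (pair-increasing x y<y′)

  x<pair : ∀ x y → x < pair x y
  x<pair zero    y = s≤s z≤n
  x<pair (suc x) y = ℕ.≤-<-trans (x<pair x y)
    (ℕ.m<m+n (pair x y) (ℕ.≤-trans (ℕ.≤-<-trans z≤n (x<pair x y)) (ℕ.m≤m+n _ 0)))

  pair-injective : ∀ x x′ {y y′} → pair x y ≡ pair x′ y′ → x ≡ x′ × y ≡ y′
  pair-injective zero    zero     {y} {y′} eq = refl , ℕ.*-cancelˡ-≡ y y′ 2 (ℕ.suc-injective eq)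
  pair-injective zero    (suc x′) {y} {y′} eq = contradiction (sym eq) (ℕ.even≢odd (pair x′ y′) y)
  pair-injective (suc x) zero     {y} {y′} eq = contradiction eq (ℕ.even≢odd (pair x y) y′)
  pair-injective (suc x) (suc x′) {y} {y′} eq
    with pair-injective x x′ (ℕ.*-cancelˡ-≡ (pair x _) (pair x′ _) 2 eq)
  ... | refl , y≡y′ = refl , y≡y′

-- The entry at an index past the end is 0.
at : ∀ {d} → Vec ℕ d → ℕ → ℕ
at []      _       = 0
at (a ∷ v) zero    = a
at (a ∷ v) (suc m) = at v m

at-toℕ : ∀ {d} (v : Vec ℕ d) l → at v (toℕ l) ≡ lookup v l
at-toℕ (a ∷ v) zero    = refl
at-toℕ (a ∷ v) (suc l) = at-toℕ v l

opposite-injective : ∀ {d} {p l : Fin d} → opposite p ≡ opposite l → p ≡ l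
opposite-injective {p = p} {l} eq =
  trans (sym (Fin.opposite-involutive p)) (trans (cong opposite eq) (Fin.opposite-involutive l))

module _ {d : ℕ} where

  -- The coefficient of ω^j belongs to the node at depth d - j; depth 0 is the root, that is, the
  -- block.
  depth : Fin d → ℕ
  depth j = suc (toℕ (opposite j))

  depth≡ : ∀ j → depth j ≡ d ∸ toℕ j
  depth≡ j = trans (cong suc (Fin.opposite-prop j)) (sym (ℕ.+-∸-assoc 1 (Fin.toℕ<n j)))

  depth-injective : ∀ {j j′} → depth j ≡ depth j′ → j ≡ j′
  depth-injective eq = opposite-injective (Fin.toℕ-injective (ℕ.suc-injective eq))

  depth-suc : ∀ j j⁻ → toℕ j ≡ suc (toℕ j⁻) → depth j⁻ ≡ suc (depth j)
  depth-suc j j⁻ eq = begin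
    depth j⁻                ≡⟨ cong suc (Fin.opposite-prop j⁻) ⟩
    suc (d ∸ suc (toℕ j⁻))  ≡⟨ cong (λ e → suc (d ∸ e)) eq ⟨
    suc (d ∸ toℕ j)         ≡⟨ cong suc (depth≡ j) ⟨
    suc (depth j)           ∎
    where open ≡-Reasoning

lex⇒first-difference : ∀ {e} {v v′ : Vec ℕ e} → v <ⱽ v′ →
  ∃ λ (l : Fin e) → (∀ {m} → m < toℕ l → at v m ≡ at v′ m) × at v (toℕ l) < at v′ (toℕ l)
lex⇒first-difference (this a<a′ _) = zero , (λ ()) , a<a′
lex⇒first-difference (next refl v<v′) with lex⇒first-difference v<v′
... | l , same , diff = suc l , (λ { {zero} _ → refl ; {suc m} (s≤s m<l) → same m<l }) , diff

first-difference⇒lex : ∀ {e} {v v′ : Vec ℕ e} (l : Fin e) →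
  (∀ {m} → m Fin.< l → lookup v m ≡ lookup v′ m) → lookup v l < lookup v′ l → v <ⱽ v′
first-difference⇒lex {v = _ ∷ _} {_ ∷ _} zero    same diff = this diff refl
first-difference⇒lex {v = _ ∷ _} {_ ∷ _} (suc l) same diff =
  next (same {zero} (s≤s z≤n)) (first-difference⇒lex l (λ m<l → same (s≤s m<l)) diff)

module _ {d k : ℕ} where

  -- Numbers the nodes of the forest with k roots in which every other node
  -- down to depth d has ω children: code y m is the ancestor of the leaf y at depth m.
  code : NF d k → ℕ → ℕ
  code (b , v) zero    = pair 0 (toℕ b)
  code (b , v) (suc m) = pair (suc (code (b , v) m)) (at v m)

  code-increasing : ∀ y → StrictlyIncreasing (code y)
  code-increasing y = steps⇒increasing λ m → ℕ.<-trans ℕ.≤-refl (x<pair (suc (code y m)) _)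

  code-parent : ∀ {y y′} m m′ → code y (suc m) ≡ code y′ (suc m′) → code y m ≡ code y′ m′
  code-parent m m′ eq = ℕ.suc-injective (proj₁ (pair-injective _ _ eq))

  -- Roots have first component 0 and all other nodes a positive one, so stripping parents from
  -- equal codes reaches both roots at once.
  code-depth : ∀ {y y′} m m′ → code y m ≡ code y′ m′ → m ≡ m′
  code-depth zero    zero     eq = refl
  code-depth zero    (suc m′) eq = contradiction (proj₁ (pair-injective 0 (suc _) eq)) λ ()
  code-depth (suc m) zero     eq = contradiction (proj₁ (pair-injective (suc _) 0 eq)) λ ()
  code-depth {y} {y′} (suc m) (suc m′) eq =
    cong suc (code-depth {y} {y′} m m′ (code-parent {y} {y′} m m′ eq))

  code-root : ∀ {y y′} m → code y m ≡ code y′ m → proj₁ y ≡ proj₁ y′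
  code-root zero    eq = Fin.toℕ-injective (proj₂ (pair-injective 0 0 eq))
  code-root {y} {y′} (suc m) eq = code-root {y} {y′} m (code-parent {y} {y′} m m eq)

  code-at : ∀ {y y′} m {l} → l < m → code y m ≡ code y′ m → at (proj₂ y) l ≡ at (proj₂ y′) l
  code-at {y} {y′} (suc m) (s≤s l≤m) eq with ℕ.m≤n⇒m<n∨m≡n l≤m
  ... | inj₁ l<m  = code-at {y} {y′} m l<m (code-parent {y} {y′} m m eq)
  ... | inj₂ refl = proj₂ (pair-injective _ _ eq)

  code-cong : ∀ {b : Fin k} {v v′ : Vec ℕ d} m → (∀ {l} → l < m → at v l ≡ at v′ l) →
              code (b , v) m ≡ code (b , v′) m
  code-cong zero    eq = refl
  code-cong {b} {v} {v′} (suc m) eq =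
    cong₂ (pair ∘ suc) (code-cong m λ l<m → eq (ℕ.m≤n⇒m≤1+n l<m)) (eq ℕ.≤-refl)

  -- Stands in for `key` on relabelled elements: their finite coefficient is `F` of the leaf if d >
  -- 0, and for d = 0 leaves are ordered like blocks.
  leaf : NF d k → ℕ
  leaf y = code y d

  leaf-injective : ∀ {y y′} → leaf y ≡ leaf y′ → y ≡ y′
  leaf-injective {y@(b , v)} {y′@(b′ , v′)} eq = cong₂ _,_
    (code-root {y} {y′} d eq) (lookup-extensional λ l →
      trans (sym (at-toℕ v l)) (trans (code-at {y} {y′} d (Fin.toℕ<n l) eq) (at-toℕ v′ l)))

  -- The relabelled copy of ω^d · k

  module Relabel {F : ℕ → ℕ} (F-increasing : StrictlyIncreasing F) where

    -- Each new coefficient encodes the whole path down to its node, so equal coefficients come from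
    -- equal nodes. Entry `l` sits at depth `l + 1`, below the unchanged block.
    relabel : NF d k → NF d k
    relabel y = proj₁ y , tabulate λ l → F (code y (suc (toℕ l)))

    relabel-coef : ∀ {n} (ys : Vec (NF d k) n) i j →
                   coef (Vec.map relabel ys) (i , j) ≡ F (code (lookup ys i) (depth j))
    relabel-coef ys i j rewrite Vec.lookup-map i relabel ys = Vec.lookup∘tabulate _ (opposite j)

    -- Comparing coefficients is comparing codes, and the conditions become facts about the forest:
    -- equal nodes have equal depths, roots and parents, and a child has a larger code than its
    -- parent. Sorting by leaves gives `zeroth-≺` and, for d = 0, `𝒴-increasing`.
    relabel-isCR : ∀ {n} {𝒴 : Fin n → Fin k} {_⪯_ : Rel (Index n d) 0ℓ} {ys : Vec (NF d k) n} →
                   AllPairs (_<_ on leaf) ys → Matches 𝒴 _⪯_ (Vec.map relabel ys) → IsCR 𝒴 _⪯_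
    relabel-isCR {n} {𝒴} {_⪯_} {ys} ys↗ m = record
      { isTotalPreorder = record
        { isPreorder = record
          { isEquivalence = isEquivalence
          ; reflexive     = λ { refl → ≤⇒⪯ ℕ.≤-refl }
          ; trans         = λ p q → ≤⇒⪯ (ℕ.≤-trans (⪯⇒≤ p) (⪯⇒≤ q))
          }
        ; total = λ a b → [ inj₁ ∘ ≤⇒⪯ , inj₂ ∘ ≤⇒⪯ ]′ (ℕ.≤-total (coef x a) (coef x b))
        }
      ; zeroth-≺     = λ i i′ z z≡0 i<i′ → <⇒≺ (subst (λ e → node i e < node i′ e)
          (sym (trans (depth≡ z) (cong (d ∸_) z≡0))) (AllPairs-lookup ys↗ i<i′))
      ; 𝒴-increasing = λ { refl i i′ i<i′ → subst₂ Fin._<_ (block′ i) (block′ i′)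
          (increasing-cancel-< (pair-increasing 0) (AllPairs-lookup ys↗ i<i′)) }
      ; ≋⇒𝒴          = λ i i′ j p → trans (sym (block′ i))
          (trans (code-root {lookup ys i} {lookup ys i′} (depth j) (≋⇒≡ p)) (block′ i′))
      ; higher-≺     = λ i j j′ j′<j → <⇒≺ (code-increasing (lookup ys i)
          (subst₂ _<_ (sym (depth≡ j)) (sym (depth≡ j′)) (ℕ.∸-monoʳ-< j′<j (ℕ.<⇒≤ (Fin.toℕ<n j)))))
      ; ≋⇒level      = λ i i′ j j′ p → depth-injective
          (code-depth {lookup ys i} {lookup ys i′} (depth j) (depth j′) (≋⇒≡ p))
      ; ≋̸-down       = λ i i′ j j⁻ j≡1+j⁻ j≋̸ j⁻≋ → j≋̸ (≡⇒≋ (code-parent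
          {lookup ys i} {lookup ys i′} _ _ (subst (λ e → node i e ≡ node i′ e) (depth-suc j j⁻ j≡1+j⁻) (≋⇒≡ j⁻≋))))
      }
      where
      open Matches m
      open Strict _⪯_
      x = Vec.map relabel ys

      node : Fin n → ℕ → ℕ
      node i = code (lookup ys i)

      block′ : ∀ i → proj₁ (lookup ys i) ≡ 𝒴 i
      block′ i = trans (sym (cong proj₁ (Vec.lookup-map i relabel ys))) (block i)

      <⇒≺ : ∀ {i j i′ j′} → node i (depth j) < node i′ (depth j′) → (i , j) ≺ (i′ , j′)
      <⇒≺ {i} {j} {i′} {j′} lt = ≤⇒⪯ (ℕ.<⇒≤ coef<) , λ q → ℕ.<⇒≱ coef< (⪯⇒≤ q)
        where
        coef< : coef x (i , j) < coef x (i′ , j′)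
        coef< = subst₂ _<_ (sym (relabel-coef ys i j)) (sym (relabel-coef ys i′ j′)) (F-increasing lt)

      ≋⇒≡ : ∀ {i j i′ j′} → (i , j) ≋ (i′ , j′) → node i (depth j) ≡ node i′ (depth j′)
      ≋⇒≡ {i} {j} {i′} {j′} (p , q) = increasing-injective F-increasing
        (trans (sym (relabel-coef ys i j)) (trans (ℕ.≤-antisym (⪯⇒≤ p) (⪯⇒≤ q)) (relabel-coef ys i′ j′)))

      ≡⇒≋ : ∀ {i i′ j} → node i (depth j) ≡ node i′ (depth j) → (i , j) ≋ (i′ , j)
      ≡⇒≋ {i} {i′} {j} eq = ≤⇒⪯ (ℕ.≤-reflexive coef≡) , ≤⇒⪯ (ℕ.≤-reflexive (sym coef≡))
        where
        coef≡ : coef x (i , j) ≡ coef x (i′ , j)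
        coef≡ = trans (relabel-coef ys i j) (trans (cong F eq) (sym (relabel-coef ys i′ j)))

    -- Above the first difference the two paths share their nodes; at it the nodes are siblings,
    -- whose codes are ordered like the old coefficients.
    relabel-increasing : ∀ {y y′} → y <ᴺ y′ → relabel y <ᴺ relabel y′
    relabel-increasing (inj₁ b<b′) = inj₁ b<b′
    relabel-increasing {b , v} {b , v′} (inj₂ (refl , v<v′)) with lex⇒first-difference v<v′
    ... | l , same , diff = inj₂ (refl , first-difference⇒lex l
      (λ {m} m<l → trans (Vec.lookup∘tabulate _ m) (trans
        (cong F (code-cong (suc (toℕ m)) λ r≤m → same (ℕ.≤-trans r≤m m<l)))
        (sym (Vec.lookup∘tabulate _ m))))
      (subst₂ _<_ (sym (Vec.lookup∘tabulate _ l)) (sym (Vec.lookup∘tabulate _ l)) (F-increasing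
        (subst (λ c → pair (suc c) (at v (toℕ l)) < pair (suc (code (b , v′) (toℕ l))) (at v′ (toℕ l)))
          (sym (code-cong (toℕ l) same)) (pair-increasing _ diff)))))

    Relabelled : NF d k → Set
    Relabelled z = ∃ λ y → relabel y ≡ z

    relabel-cancel : ∀ {y y′} → relabel y <ᴺ relabel y′ → y <ᴺ y′
    relabel-cancel {y} {y′} lt with <ᴺ.compare y y′
    ... | tri< y<y′ _ _ = y<y′
    ... | tri≈ _ refl _ = contradiction lt (<ᴺ.irrefl refl)
    ... | tri> _ _ y′<y = contradiction (relabel-increasing y′<y) (<ᴺ.asym lt)

    relabel-injective : ∀ {y y′} → relabel y ≡ relabel y′ → y ≡ y′
    relabel-injective {y} {y′} eq with <ᴺ.compare y y′
    ... | tri< y<y′ _ _ = contradiction (relabel-increasing y<y′) (<ᴺ.irrefl eq)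
    ... | tri≈ _ y≡y′ _ = y≡y′
    ... | tri> _ _ y′<y = contradiction (relabel-increasing y′<y) (<ᴺ.irrefl (sym eq))

    relabelled≈ : OrderEquivalent (ω^ d · k) Relabelled
    relabelled≈ = (proj₁ ∘ proj₂) , record
      { isOrderMonomorphism = record
        { isOrderHomomorphism = record
          { cong = λ { {_ , _ , refl} {_ , _ , refl} eq → relabel-injective eq }
          ; mono = λ { {_ , _ , refl} {_ , _ , refl} lt → relabel-cancel lt }
          }
        ; injective = λ { {_ , _ , refl} {_ , _ , refl} refl → refl }
        ; cancel    = λ { {_ , _ , refl} {_ , _ , refl} lt → relabel-increasing lt }
        }
      ; surjective = λ y → (relabel y , y , refl) , λ { {_ , _ , refl} eq → relabel-injective eq }
      }

-- The upper bound

indices : ∀ n d → List (Index n d)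
indices n d = List.cartesianProduct (List.allFin n) (List.allFin d)

∈-indices : ∀ {n d} (a : Index n d) → a List.∈ indices n d
∈-indices (i , j) = List.∈-cartesianProduct⁺ (List.∈-allFin i) (List.∈-allFin j)

cr-at : ∀ n d k (q : Fin P[ n ,ω^ d · k ]) → CR n d k (List.lookup (CRs n d k) q)
cr-at n d k q = Equivalence.to (∈-CRs _) (List.∈-lookup q)

cr-index : ∀ {n d k p} → CR n d k p → ∃ λ q → List.lookup (CRs n d k) q ≡ p
cr-index cr = let p∈ = Equivalence.from (∈-CRs _) cr in ListAny.index p∈ , sym (ListAny.lookup-index p∈)

∣p∪q∣≤∣p∣+∣q∣ : ∀ {c} (p q : Subset c) → ∣ p Subset.∪ q ∣ ≤ ∣ p ∣ + ∣ q ∣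
∣p∪q∣≤∣p∣+∣q∣ []          []          = z≤n
∣p∪q∣≤∣p∣+∣q∣ (false ∷ p) (false ∷ q) = ∣p∪q∣≤∣p∣+∣q∣ p q
∣p∪q∣≤∣p∣+∣q∣ (false ∷ p) (true ∷ q)  =
  ℕ.≤-trans (s≤s (∣p∪q∣≤∣p∣+∣q∣ p q)) (ℕ.≤-reflexive (sym (ℕ.+-suc ∣ p ∣ ∣ q ∣)))
∣p∪q∣≤∣p∣+∣q∣ (true ∷ p)  (false ∷ q) = s≤s (∣p∪q∣≤∣p∣+∣q∣ p q)
∣p∪q∣≤∣p∣+∣q∣ (true ∷ p)  (true ∷ q)  =
  s≤s (ℕ.≤-trans (∣p∪q∣≤∣p∣+∣q∣ p q) (ℕ.+-monoʳ-≤ ∣ p ∣ (ℕ.n≤1+n ∣ q ∣)))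

opaque

  comprehension : ExcludedMiddle 0ℓ → ∀ {c} (Q : Fin c → Set) → ∃ λ C → ∀ i → i Subset.∈ C ⇔ Q i
  comprehension em Q = tabulate (λ i → does (em {Q i})) , λ i → mk⇔
    (λ i∈ → does-true em (trans (sym (Vec.lookup∘tabulate _ i)) (Vec.[]=⇒lookup i∈)))
    (λ Qi → Vec.lookup⇒[]= i _ (trans (Vec.lookup∘tabulate _ i) (dec-true em Qi)))
    where
    does-true : ∀ {A : Set} (a? : Dec A) → does a? ≡ true → A
    does-true (yes a) _ = a

image : ∀ {P c} → (Fin P → Fin c) → Subset c
image {zero}  e = Subset.⊥
image {suc P} e = Subset.⁅ e zero ⁆ Subset.∪ image (e ∘ suc)

∈-image : ∀ {P c} (e : Fin P → Fin c) q → e q Subset.∈ image e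
∈-image e zero    = Subset.x∈p∪q⁺ (inj₁ (Subset.x∈⁅x⁆ (e zero)))
∈-image e (suc q) = Subset.x∈p∪q⁺ {p = Subset.⁅ e zero ⁆} (inj₂ (∈-image (e ∘ suc) q))

∣image∣≤ : ∀ {P c} (e : Fin P → Fin c) → ∣ image e ∣ ≤ P
∣image∣≤ {zero}  {c} e = ℕ.≤-reflexive (Subset.∣⊥∣≡0 c)
∣image∣≤ {suc P}     e = ℕ.≤-trans (∣p∪q∣≤∣p∣+∣q∣ Subset.⁅ e zero ⁆ (image (e ∘ suc)))
  (ℕ.+-mono-≤ (ℕ.≤-reflexive (Subset.∣⁅x⁆∣≡1 (e zero))) (∣image∣≤ (e ∘ suc)))

map-preimage : ∀ {A B : Set} {f : A → B} {n} {xs : Vec B n} →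
               All (λ x → ∃ λ y → f y ≡ x) xs → ∃ λ ys → Vec.map f ys ≡ xs
map-preimage []                = [] , refl
map-preimage ((y , refl) ∷ ps) = let ys , eq = map-preimage ps in y ∷ ys , cong (_ ∷_) eq

≐-map : ∀ {A B : Set} (f : A → B) {m n} {xs : Vec A m} {ys : Vec A n} →
        xs ≐ ys → Vec.map f xs ≐ Vec.map f ys
≐-map f (⊆ , ⊇) = mono ⊆ , mono ⊇
  where
  mono : ∀ {m n} {xs : Vec _ m} {ys : Vec _ n} →
         (∀ {z} → z ∈ xs → z ∈ ys) → ∀ {z} → z ∈ Vec.map f xs → z ∈ Vec.map f ys
  mono h z∈ with Vec.fromAny (VecAny.map⁻ z∈)
  ... | y , y∈ , refl = Vec.∈-map⁺ f (h y∈)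

-- Colors of subsets of the relabelled copy

module UpperBound (em : ExcludedMiddle 0ℓ) {n d k : ℕ}
                  {P : ℕ} (cr : Fin P → Pair n d k) (cr-isCR : ∀ q → CR n d k (cr q))
                  (cr-complete : ∀ {p} → CR n d k p → ∃ λ q → cr q ≡ p)
                  {c : ℕ} (1≤c : 1 ≤ c) (COL : (ω^ d · k) choose n → Fin c) where

  module R (q : Fin P) = Rank (λ a b → T? _) (IsCR.isTotalPreorder (cr-isCR q)) (indices n d) ∈-indices

  -- The common `bound` of the rank functions of all rules, so one vector length serves them all.
  N : ℕ
  N = suc (length (indices n d))

  slot : Fin P → Index n d → Fin N
  slot q a = fromℕ< (R.rank<bound q a)

  tuple : Fin P → Vec ℕ N → Vec (NF d k) n
  tuple q Y = assemble (lookup (proj₁ (cr q))) (lookup Y ∘ slot q)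

  χ : Fin P → Vec ℕ N → Fin c
  χ q Y with em {∃ λ (s : (ω^ d · k) choose n) → value s ≐ tuple q Y}
  ... | yes (s , _) = COL s
  -- For arbitrary `Y` the tuple may repeat an element and enumerate no n-set; any color will do
  -- then.
  ... | no _        = fromℕ< 1≤c

  χ-COL : ∀ q Y {s} → value s ≐ tuple q Y → χ q Y ≡ COL s
  χ-COL q Y {s} s≐ with em {∃ λ (s : (ω^ d · k) choose n) → value s ≐ tuple q Y}
  ... | yes (s′ , s′≐) = cong COL (choose-unique em (≐-trans s′≐ (≐-sym s≐)))
  ... | no ∄s          = contradiction (s , s≐) ∄s

  module Homogeneous {h} (h-increasing : StrictlyIncreasing h) (e : Fin P → Fin c)
    (hom : ∀ q {X} → StrictlyIncreasing X → χ q (tabulate (h ∘ X ∘ toℕ)) ≡ e q) where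

    -- The multiples of `N` are the values prescribed in the interpolation of ranks; the values of
    -- `h` in between are left for the ranks not taken.
    F : ℕ → ℕ
    F a = h (suc a * N)

    F-increasing : StrictlyIncreasing F
    F-increasing a<b = h-increasing (ℕ.*-monoˡ-< N (s≤s a<b))

    open Relabel {d} {k} F-increasing

    -- The node codes, placed at their ranks, extend to an increasing `X`. Rule `q` rebuilds the
    -- tuple from `h ∘ X`, and homogeneity fixes its color.
    color-determined : ∀ q {zs s} → MatchesPair (cr q) (Vec.map relabel zs) →
                       value s ≐ Vec.map relabel zs → COL s ≡ e q
    color-determined q {zs} {s} m s≐x = trans (sym (χ-COL q Y (subst (value s ≐_) (sym tuple≡x) s≐x)))
      (hom q {X} λ {m} {m′} → X-increasing {m} {m′})
      where
      open Matches m
      x = Vec.map relabel zs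

      node : Index n d → ℕ
      node (i , j) = code (lookup zs i) (depth j)

      node-mono : ∀ {a b} → rel (proj₂ (cr q)) a b → node a ≤ node b
      node-mono {a@(i , j)} {b@(i′ , j′)} a⪯b = increasing-cancel-≤ F-increasing
        (subst₂ _≤_ (relabel-coef zs i j) (relabel-coef zs i′ j′) (⪯⇒≤ a⪯b))

      node-cancel : ∀ {a b} → node a ≤ node b → rel (proj₂ (cr q)) a b
      node-cancel {a@(i , j)} {b@(i′ , j′)} a≤b = ≤⇒⪯
        (subst₂ _≤_ (sym (relabel-coef zs i j)) (sym (relabel-coef zs i′ j′))
          (increasing-≤ F-increasing a≤b))

      interpolant  = R.interpolation q node
                       (λ {a} {b} → node-mono {a} {b}) (λ {a} {b} → node-cancel {a} {b})
      X            = proj₁ interpolant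
      X-increasing = proj₁ (proj₂ interpolant)
      X-rank       = proj₂ (proj₂ interpolant)

      Y : Vec ℕ N
      Y = tabulate (h ∘ X ∘ toℕ)

      entry : ∀ a → lookup Y (slot q a) ≡ coef x a
      entry a@(i , j) = begin
        lookup Y (slot q a)      ≡⟨ Vec.lookup∘tabulate (h ∘ X ∘ toℕ) (slot q a) ⟩
        h (X (toℕ (slot q a)))   ≡⟨ cong (h ∘ X) (Fin.toℕ-fromℕ< (R.rank<bound q a)) ⟩
        h (X (R.rank q a))       ≡⟨ cong h (X-rank a) ⟩
        F (node a)               ≡⟨ relabel-coef zs i j ⟨
        coef x a                 ∎
        where open ≡-Reasoning

      tuple≡x : tuple q Y ≡ x
      tuple≡x = tuple-extensional
        (λ i → trans (assemble-block (lookup (proj₁ (cr q))) (lookup Y ∘ slot q) i) (sym (block i)))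
        (λ a → trans (assemble-coef (lookup (proj₁ (cr q))) (lookup Y ∘ slot q) a) (entry a))

    -- Once the preimages of the members are sorted by leaf code, the pattern of the relabelled
    -- tuple is a coloring rule, and that rule determines the color.
    color-from-rule : ∀ (s : (ω^ d · k) choose n) → _⊆ˢ_ (ω^ d · k) s Relabelled → ∃ λ q → e q ≡ COL s
    color-from-rule s s⊆ with map-preimage s⊆
    ... | ys , map≡s with sort {R = _<_ on leaf} ℕ.<-trans leaf-compare ys≢
      where
      leaf-compare : ∀ {y y′ : NF d k} → y ≢ y′ → leaf y < leaf y′ ⊎ leaf y′ < leaf y
      leaf-compare {y} {y′} y≢y′ with ℕ.<-cmp (leaf y) (leaf y′)
      ... | tri< lt _ _ = inj₁ lt
      ... | tri≈ _ eq _ = contradiction (leaf-injective eq) y≢y′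
      ... | tri> _ _ gt = inj₂ gt
      ys≢ : AllPairs _≢_ ys
      ys≢ = AllPairs-tabulate λ {i} {j} i<j yi≡yj → <ᴺ.irrefl
        (trans (Vec.lookup-map i relabel ys)
          (trans (cong relabel yi≡yj) (sym (Vec.lookup-map j relabel ys))))
        (AllPairs-lookup (subst (AllPairs _<ᴺ_) (sym map≡s) (choose-sorted em s)) i<j)
    ... | zs , zs↗ , zs≐ys
      with cr-complete {pattern-of (Vec.map relabel zs)}
             (relabel-isCR zs↗ (matches-pattern (Vec.map relabel zs)))
    ... | q , crq≡p = q , sym (color-determined q {zs} {s}
        (subst (λ p → MatchesPair p (Vec.map relabel zs)) (sym crq≡p)
          (matches-pattern (Vec.map relabel zs)))
        (subst (_≐ Vec.map relabel zs) map≡s (≐-map relabel (≐-sym zs≐ys))))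

    colors : Subset c
    colors = proj₁ (comprehension em λ i → ∃ λ s → _⊆ˢ_ (ω^ d · k) s Relabelled × COL s ≡ i)

    colors-isImage : IsImage (ω^ d · k) COL Relabelled colors
    colors-isImage = proj₂ (comprehension em λ i → ∃ λ s → _⊆ˢ_ (ω^ d · k) s Relabelled × COL s ≡ i)

    ∣colors∣≤P : ∣ colors ∣ ≤ P
    ∣colors∣≤P = ℕ.≤-trans (Subset.p⊆q⇒∣p∣≤∣q∣ (λ {i} → colors⊆image i)) (∣image∣≤ e)
      where
      colors⊆image : ∀ i → i Subset.∈ colors → i Subset.∈ image e
      colors⊆image i i∈ =
        let s , s⊆ , COLs≡i = Equivalence.to (colors-isImage i) i∈
            q , eq≡COLs     = color-from-rule s s⊆
        in subst (Subset._∈ image e) (trans eq≡COLs COLs≡i) (∈-image e q)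

upper-bound : ExcludedMiddle 0ℓ → ∀ n d k → Bounds (ω^ d · k) n P[ n ,ω^ d · k ]
upper-bound em n d k c 1≤c COL =
  let open UpperBound em {n} {d} {k} (List.lookup (CRs n d k)) (cr-at n d k) cr-index 1≤c COL
      h , h↗ , e , hom = Ramsey.homogeneous-sequence em N _ χ
      open Homogeneous h↗ e hom
      open Relabel {d} {k} F-increasing
  in Relabelled , relabelled≈ , colors , colors-isImage , ∣colors∣≤P

-- The lower bound

Full : ∀ d → (Vec ℕ d → Set) → Set
Full zero    Q = Q []
Full (suc d) Q = Infinite λ a → Full d (Q ∘ (a ∷_))

-- Only the first l entries of v matter: the node they lead to is the root of a full subtree.
FullFrom : ∀ {d} → (Vec ℕ d → Set) → ℕ → Vec ℕ d → Set
FullFrom {d} Q zero    v       = Full d Q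
FullFrom     Q (suc l) []      = Q []
FullFrom     Q (suc l) (a ∷ v) = FullFrom (Q ∘ (a ∷_)) l v

FullFrom-all : ∀ {d} {Q : Vec ℕ d → Set} v → FullFrom Q d v → Q v
FullFrom-all []      q = q
FullFrom-all (a ∷ v) q = FullFrom-all v q

FullFrom-cong : ∀ {d} {Q : Vec ℕ d → Set} l {v w} → (∀ p → toℕ p < l → lookup v p ≡ lookup w p) →
                FullFrom Q l v → FullFrom Q l w
FullFrom-cong zero    eq q = q
FullFrom-cong (suc l) {[]}    {[]}    eq q = q
FullFrom-cong {Q = Q} (suc l) {a ∷ v} {b ∷ w} eq q =
  subst (λ c → FullFrom (Q ∘ (c ∷_)) l w) (eq zero (s≤s z≤n))
    (FullFrom-cong l (λ p p<l → eq (suc p) (s≤s p<l)) q)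

-- The choice of `a` precedes that of `w` because one coefficient has to serve every element whose
-- path runs through this node.
FullFrom-extend : ∀ {d} {Q : Vec ℕ d → Set} l {v} → FullFrom Q (toℕ l) v → Infinite λ a →
  ∀ w → (∀ {p} → p Fin.< l → lookup v p ≡ lookup w p) → lookup w l ≡ a → FullFrom Q (suc (toℕ l)) w
FullFrom-extend zero    {_ ∷ _} q m = let a , m<a , full = q m in
  a , m<a , λ { (_ ∷ _) _ refl → full }
FullFrom-extend {Q = Q} (suc l) {b ∷ _} q m =
  let a , m<a , ext = FullFrom-extend {Q = Q ∘ (b ∷_)} l q m in
  a , m<a , λ { (c ∷ w) eq eq-a →
    subst (λ b → FullFrom (Q ∘ (b ∷_)) (suc (toℕ l)) w) (eq {zero} (s≤s z≤n))
      (ext w (λ p<l → eq (s≤s p<l)) eq-a) }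

-- Increasing self-maps of well-orders and full subtrees

module _ {A : Set} {_<′_ : Rel A 0ℓ} {f : A → A} (f-mono : ∀ {x y} → x <′ y → f x <′ f y) where

  -- From `f x` below `x` follows `f (f x)` below `f x`, and so on: an infinite descent.
  increasing-≮ : WellFounded _<′_ → ∀ x → ¬ f x <′ x
  increasing-≮ wf x = go (wf x)
    where
    go : ∀ {x} → Acc _<′_ x → ¬ f x <′ x
    go (acc rec) fx<x = go (rec fx<x) (f-mono fx<x)

<ⱽ-wellFounded : ∀ {d} → WellFounded (_<ⱽ_ {d})
<ⱽ-wellFounded = VecLex.<-wellFounded trans (λ { refl p → p }) <-wellFounded

-- The vectors beyond r contain a copy of all vectors; for d = 0 there is only r itself.
shift : ∀ {d} → Vec ℕ d → Vec ℕ d → Vec ℕ d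
shift []      []      = []
shift (x ∷ _) (y ∷ v) = suc x + y ∷ v

shift-increasing : ∀ {d} (r : Vec ℕ d) {v w} → v <ⱽ w → shift r v <ⱽ shift r w
shift-increasing (x ∷ r) {_ ∷ _} {_ ∷ _} (this y<y′ _)   = this (ℕ.+-monoʳ-< (suc x) y<y′) refl
shift-increasing (x ∷ r) {_ ∷ _} {_ ∷ _} (next refl v<w) = next refl v<w

shift-≥ : ∀ {d} (r v : Vec ℕ d) → r ≡ shift r v ⊎ r <ⱽ shift r v
shift-≥ []      []      = inj₁ refl
shift-≥ (x ∷ r) (y ∷ v) = inj₂ (this (s≤s (ℕ.m≤m+n x y)) refl)

<ⱽ-head : ∀ {d} {v w : Vec ℕ (suc d)} → v <ⱽ w → Vec.head v ≤ Vec.head w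
<ⱽ-head (this a<b _)    = ℕ.<⇒≤ a<b
<ⱽ-head (next refl v<w) = ℕ.≤-refl

<ⱽ-tail : ∀ {d} {v w : Vec ℕ (suc d)} → Vec.head v ≡ Vec.head w → v <ⱽ w → Vec.tail v <ⱽ Vec.tail w
<ⱽ-tail refl (this a<a _) = contradiction a<a (ℕ.<-irrefl refl)
<ⱽ-tail refl (next _ v<w) = v<w

module Fullness (em : ExcludedMiddle 0ℓ) where

  -- As long as a larger value occurs beyond `r`, move `r` there. Each move raises `g r`, so the
  -- bound `B` allows finitely many; `t` limits those that remain.
  eventually-constant : ∀ {d} (g : Vec ℕ d → ℕ) → (∀ {v w} → v <ⱽ w → g v ≤ g w) →
                        ∀ B → (∀ v → g v ≤ B) → ∃ λ r → ∀ {v} → r <ⱽ v → g v ≡ g r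
  eventually-constant {d} g g-mono B g≤B = climb B (Vec.replicate d 0) (ℕ.m≤n+m B _)
    where
    climb : ∀ t r → B ≤ g r + t → ∃ λ r → ∀ {v} → r <ⱽ v → g v ≡ g r
    climb t r B≤ with em {∃ λ v → r <ⱽ v × g r < g v}
    ... | no ∄v = r , λ {v} r<v → ℕ.≤-antisym (ℕ.≮⇒≥ λ gr<gv → ∄v (v , r<v , gr<gv)) (g-mono r<v)
    climb zero    r B≤ | yes (v , _ , gr<gv) =
      contradiction (ℕ.≤-trans (g≤B v) (ℕ.≤-trans B≤ (ℕ.≤-reflexive (ℕ.+-identityʳ _)))) (ℕ.<⇒≱ gr<gv)
    climb (suc t) r B≤ | yes (v , _ , gr<gv) =
      climb t v (ℕ.≤-trans B≤ (ℕ.≤-trans (ℕ.≤-reflexive (ℕ.+-suc (g r) t)) (ℕ.+-monoˡ-≤ t gr<gv)))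

  -- The images of the vectors starting with `suc m` have heads bounded by that of the first image
  -- of the next column, so from some `r` on the head is a constant `a`. It is not below `suc m`, by
  -- `increasing-≮`. The tails of the images from `r` on contain an increasing image of all vectors,
  -- to which induction applies.
  full-image : ∀ d {f : Vec ℕ d → Vec ℕ d} → (∀ {v w} → v <ⱽ w → f v <ⱽ f w) →
               ∀ {Q} → (∀ v → Q (f v)) → Full d Q
  full-image zero {f} f-mono {Q} Qf = subst Q (empty (f [])) (Qf [])
    where
    empty : (v : Vec ℕ 0) → v ≡ []
    empty [] = refl
  full-image (suc d) {f} f-mono {Q} Qf m = a , m<a , full-image d f′-mono Qf′
    where
    column : Vec ℕ d → Vec ℕ (suc d)
    column v = f (suc m ∷ v)

    B = Vec.head (f (suc (suc m) ∷ Vec.replicate d 0))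

    constant = eventually-constant (Vec.head ∘ column) (λ v<w → <ⱽ-head (f-mono (next refl v<w)))
      B (λ v → <ⱽ-head (f-mono (this ℕ.≤-refl refl)))
    r = proj₁ constant
    a = Vec.head (column r)

    m<a : m < a
    m<a = ℕ.≮⇒≥ λ a<1+m → increasing-≮ f-mono <ⱽ-wellFounded (suc m ∷ r) (head<⇒< a<1+m)
      where
      head<⇒< : ∀ {v w : Vec ℕ (suc d)} → Vec.head v < Vec.head w → v <ⱽ w
      head<⇒< {_ ∷ _} {_ ∷ _} a<b = this a<b refl

    head≡a : ∀ v → Vec.head (column (shift r v)) ≡ a
    head≡a v with shift-≥ r v
    ... | inj₁ r≡ = cong (Vec.head ∘ column) (sym r≡)
    ... | inj₂ r< = proj₂ constant r<

    f′ : Vec ℕ d → Vec ℕ d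
    f′ v = Vec.tail (column (shift r v))

    f′-mono : ∀ {v w} → v <ⱽ w → f′ v <ⱽ f′ w
    f′-mono {v} {w} v<w = <ⱽ-tail (trans (head≡a v) (sym (head≡a w)))
      (f-mono (next refl (shift-increasing r v<w)))

    Qf′ : ∀ v → Q (a ∷ f′ v)
    Qf′ v = subst Q (head-tail (column (shift r v)) (head≡a v)) (Qf _)
      where
      head-tail : ∀ (v : Vec ℕ (suc d)) → Vec.head v ≡ a → v ≡ a ∷ Vec.tail v
      head-tail (_ ∷ _) refl = refl

  module _ {d k : ℕ} {f : NF d k → NF d k} (f-mono : ∀ {x y} → x <ᴺ y → f x <ᴺ f y) where

    <ᴺ-block : ∀ {x y : NF d k} → x <ᴺ y → proj₁ x Fin.≤ proj₁ y
    <ᴺ-block (inj₁ b<b′)       = ℕ.<⇒≤ b<b′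
    <ᴺ-block (inj₂ (refl , _)) = ℕ.≤-refl

    <ᴺ-vector : ∀ {x y : NF d k} → proj₁ x ≡ proj₁ y → x <ᴺ y → proj₂ x <ⱽ proj₂ y
    <ᴺ-vector refl (inj₁ b<b)       = contradiction b<b (ℕ.<-irrefl refl)
    <ᴺ-vector refl (inj₂ (_ , v<w)) = v<w

    block-≥ : ∀ b v → b Fin.≤ proj₁ (f (b , v))
    block-≥ b v = ℕ.≮⇒≥ λ lt → increasing-≮ f-mono <ᴺ-wellFounded (b , v) (inj₁ lt)

    -- If f left the block b for the next one, it would embed ω^d into a proper
    -- initial segment of that block.
    block-≤ : ∀ t b → k ≤ toℕ b + suc t → ∀ v → proj₁ (f (b , v)) Fin.≤ b
    block-≤ zero    b k≤ v = ℕ.≤-pred (ℕ.≤-trans (Fin.toℕ<n _)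
      (ℕ.≤-trans k≤ (ℕ.≤-reflexive (ℕ.+-comm (toℕ b) 1))))
    block-≤ (suc t) b k≤ v = ℕ.≮⇒≥ escape
      where
      escape : ¬ b Fin.< proj₁ (f (b , v))
      -- The map sends `w` to the vector of `f (b , shift v w)`. All its values lie below `z`, so
      -- its value at `z` does too.
      escape b<fb = increasing-≮ g-mono <ⱽ-wellFounded z
        (<ᴺ-vector (trans (block-g z) (sym block-b′)) (f-mono (inj₁ b<b′)))
        where
        1+b<k = ℕ.≤-<-trans b<fb (Fin.toℕ<n (proj₁ (f (b , v))))
        b′ : Fin k
        b′ = fromℕ< 1+b<k
        toℕb′ : toℕ b′ ≡ suc (toℕ b)
        toℕb′ = Fin.toℕ-fromℕ< 1+b<k
        b<b′ : b Fin.< b′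
        b<b′ = ℕ.≤-reflexive (sym toℕb′)
        block-b′ : proj₁ (f (b′ , v)) ≡ b′
        block-b′ = Fin.toℕ-injective (ℕ.≤-antisym
          (block-≤ t b′ (subst (λ e → k ≤ e + suc t) (sym toℕb′)
            (subst (k ≤_) (ℕ.+-suc (toℕ b) (suc t)) k≤)) v)
          (block-≥ b′ v))
        z : Vec ℕ d
        z = proj₂ (f (b′ , v))
        -- From `v` on the images have left `b`, and they stay below `f (b′ , v)`, which lies in
        -- `b′`.
        block-g : ∀ w → proj₁ (f (b , shift v w)) ≡ b′
        block-g w = Fin.toℕ-injective (ℕ.≤-antisym
          (subst (λ e → proj₁ (f (b , shift v w)) Fin.≤ e) block-b′ (<ᴺ-block (f-mono (inj₁ b<b′))))
          (subst (_≤ toℕ (proj₁ (f (b , shift v w)))) (sym toℕb′) (ℕ.≤-trans b<fb fv≤)))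
          where
          fv≤ : proj₁ (f (b , v)) Fin.≤ proj₁ (f (b , shift v w))
          fv≤ with shift-≥ v w
          ... | inj₁ v≡ = ℕ.≤-reflexive (cong (λ v → toℕ (proj₁ (f (b , v)))) v≡)
          ... | inj₂ v< = <ᴺ-block (f-mono (inj₂ (refl , v<)))
        g-mono : ∀ {w w′} → w <ⱽ w′ → proj₂ (f (b , shift v w)) <ⱽ proj₂ (f (b , shift v w′))
        g-mono {w} {w′} w<w′ = <ᴺ-vector (trans (block-g w) (sym (block-g w′)))
          (f-mono (inj₂ (refl , shift-increasing v w<w′)))

    block-fixed : ∀ b v → proj₁ (f (b , v)) ≡ b
    block-fixed b v = Fin.toℕ-injective (ℕ.≤-antisym
      (block-≤ k b (ℕ.≤-trans (ℕ.n≤1+n k) (ℕ.m≤n+m (suc k) (toℕ b))) v) (block-≥ b v))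

    full-blocks : ∀ {S′ : NF d k → Set} → (∀ y → S′ (f y)) → ∀ b → Full d (λ v → S′ (b , v))
    full-blocks {S′} S′f b = full-image d
      (λ {v} {w} v<w → <ᴺ-vector (trans (block-fixed b v) (sym (block-fixed b w)))
        (f-mono (inj₂ (refl , v<w))))
      (λ v → subst (λ b → S′ (b , proj₂ (f (_ , v)))) (block-fixed b v) (S′f (b , v)))

  -- The inverse of the isomorphism is an increasing self-map of ω^d · k with values in `S′`.
  orderEquivalent⇒full : ∀ {d k} {S′ : NF d k → Set} → OrderEquivalent (ω^ d · k) S′ →
                         ∀ b → Full d (λ v → S′ (b , v))
  orderEquivalent⇒full {d} {k} {S′} (g , iso) =
    full-blocks {f = f} f-mono (λ y → proj₂ (proj₁ (surjective y)))
    where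
    open IsOrderIsomorphism iso
    f : NF d k → NF d k
    f y = proj₁ (proj₁ (surjective y))
    g∘f : ∀ y → g (proj₁ (surjective y)) ≡ y
    g∘f y = proj₂ (surjective y) {proj₁ (surjective y)} refl
    f-mono : ∀ {x y} → x <ᴺ y → f x <ᴺ f y
    f-mono {x} {y} x<y = cancel (subst₂ _<ᴺ_ (sym (g∘f x)) (sym (g∘f y)) x<y)

-- Realizing a coloring rule in a full set

opposite-anti : ∀ {d} {p l : Fin d} → p Fin.< l → opposite l Fin.< opposite p
opposite-anti {d} {p} {l} p<l = subst₂ _<_ (sym (Fin.opposite-prop l)) (sym (Fin.opposite-prop p))
  (ℕ.∸-monoʳ-< (s≤s p<l) (Fin.toℕ<n l))

module _ {A : Set} (f : ℕ → A) (r : ℕ) (a : A) where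

  update : ℕ → A
  update s with s ℕ.≟ r
  ... | yes _ = a
  ... | no _  = f s

  update-same : ∀ {s} → s ≡ r → update s ≡ a
  update-same {s} s≡r with s ℕ.≟ r
  ... | yes _  = refl
  ... | no s≢r = contradiction s≡r s≢r

  update-other : ∀ {s} → s ≢ r → update s ≡ f s
  update-other {s} s≢r with s ℕ.≟ r
  ... | yes s≡r = contradiction s≡r s≢r
  ... | no _    = refl

module Realization (em : ExcludedMiddle 0ℓ) {n d k : ℕ} {𝒴 : Fin n → Fin k} {_⪯_ : Rel (Index n d) 0ℓ}
                   (cr : IsCR 𝒴 _⪯_) {S′ : NF d k → Set} (full : ∀ b → Full d (λ v → S′ (b , v))) where
  open IsCR cr
  open Strict _⪯_
  open Rank (λ a b → em {a ⪯ b}) isTotalPreorder (indices n d) ∈-indices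

  -- Positions run from the leading coefficient, so by `higher-≺` the ranks increase along each
  -- path.
  ρ : Fin n → Fin d → ℕ
  ρ i l = rank (i , opposite l)

  ρ-increasing : ∀ i {p l} → p Fin.< l → ρ i p < ρ i l
  ρ-increasing i {p} {l} p<l =
    let below , ¬above = higher-≺ i (opposite p) (opposite l) (opposite-anti p<l)
    in rank-mono-< below ¬above

  ρ≡⇒≋ : ∀ {i i′ l l′} → ρ i l ≡ ρ i′ l′ → (i , opposite l) ≋ (i′ , opposite l′)
  ρ≡⇒≋ eq = rank-cancel (ℕ.≤-reflexive eq) , rank-cancel (ℕ.≤-reflexive (sym eq))

  -- The contrapositive of `≋̸-down`, iterated over `t` levels.
  ≋-up : ∀ {i i′} t {j j⁺} → toℕ j⁺ ≡ t + toℕ j → (i , j) ≋ (i′ , j) → (i , j⁺) ≋ (i′ , j⁺)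
  ≋-up zero    eq j≋ rewrite Fin.toℕ-injective eq = j≋
  ≋-up {i} {i′} (suc t) {j} {j⁺} eq j≋ = decidable-stable em λ j⁺≋̸ →
    ≋̸-down i i′ j⁺ j₁ (trans eq (cong suc (sym toℕj₁))) j⁺≋̸ (≋-up t toℕj₁ j≋)
    where
    t+j<d = ℕ.≤-trans (ℕ.≤-reflexive (sym eq)) (ℕ.<⇒≤ (Fin.toℕ<n j⁺))
    j₁ : Fin d
    j₁ = fromℕ< t+j<d
    toℕj₁ : toℕ j₁ ≡ t + toℕ j
    toℕj₁ = Fin.toℕ-fromℕ< t+j<d

  ρ-prefix : ∀ {i i′ l} → ρ i l ≡ ρ i′ l → ∀ {p} → p Fin.< l → ρ i p ≡ ρ i′ p
  ρ-prefix {i} {i′} {l} eq {p} p<l = ℕ.≤-antisym (rank-mono (proj₁ p≋)) (rank-mono (proj₂ p≋))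
    where
    p≋ : (i , opposite p) ≋ (i′ , opposite p)
    p≋ = ≋-up (toℕ (opposite p) ∸ toℕ (opposite l))
      (sym (ℕ.m∸n+n≡m (ℕ.<⇒≤ (opposite-anti p<l)))) (ρ≡⇒≋ eq)

  vector : (ℕ → ℕ) → Fin n → Vec ℕ d
  vector val i = tabulate λ l → val (ρ i l)

  lookup-vector : ∀ val i l → lookup (vector val i) l ≡ val (ρ i l)
  lookup-vector val i = Vec.lookup∘tabulate (λ l → val (ρ i l))

  Subtree : Fin n → ℕ → Vec ℕ d → Set
  Subtree i l v = FullFrom (λ v → S′ (𝒴 i , v)) l v

  -- Coefficients are chosen in the order of their ranks; this is the invariant
  -- once all those of rank below r are fixed.
  record Chosen (r : ℕ) (val : ℕ → ℕ) : Set where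
    field
      increasing : ∀ {s s′} → s < s′ → s′ < r → val s < val s′
      subtree    : ∀ i l → (∀ p → toℕ p < l → ρ i p < r) → l ≤ d → Subtree i l (vector val i)

  choose-first : Chosen 0 (λ _ → 0)
  choose-first = record
    { increasing = λ _ ()
    ; subtree    = λ { i zero _ _ → full (𝒴 i)
                     ; i (suc l) ρ<0 l<d → contradiction
                         (ρ<0 (fromℕ< l<d) (s≤s (ℕ.≤-reflexive (Fin.toℕ-fromℕ< l<d)))) λ () }
    }

  module Next {r val} (chosen : Chosen r val) where
    open Chosen chosen

    bounded = Fin-bounded {r} (val ∘ toℕ)
    M       = proj₁ bounded

    val≤M : ∀ {s} → s < r → val s ≤ M
    val≤M s<r = subst (λ s → val s ≤ M) (Fin.toℕ-fromℕ< s<r) (proj₂ bounded (fromℕ< s<r))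

    agree : ∀ {a i} {l : Fin d} → (∀ p → p Fin.< l → ρ i p < r) →
            ∀ p → p Fin.< l → lookup (vector val i) p ≡ lookup (vector (update val r a) i) p
    agree {a} {i} ρ<r p p<l = begin
      lookup (vector val i) p                ≡⟨ lookup-vector val i p ⟩
      val (ρ i p)                            ≡⟨ update-other val r a (ℕ.<⇒≢ (ρ<r p p<l)) ⟨
      update val r a (ρ i p)                 ≡⟨ lookup-vector (update val r a) i p ⟨
      lookup (vector (update val r a) i) p   ∎
      where open ≡-Reasoning

    Extends : ℕ → Set
    Extends a = ∀ i l → ρ i l ≡ r → Subtree i (suc (toℕ l)) (vector (update val r a) i)

    -- Indices of rank `r` are equivalent, so they share their level, their block and, by
    -- `ρ-prefix`, all earlier coefficients. Hence they all ask for a child of one node, and a child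
    -- beyond `M` with a full subtree serves them together.
    extension : ∃ λ a → M < a × Extends a
    extension with em {∃₂ λ i l → ρ i l ≡ r}
    -- No index has rank `r`: the value only has to keep the sequence increasing.
    ... | no ∄   = suc M , ℕ.≤-refl , λ i l ρ≡r → contradiction (i , l , ρ≡r) ∄
    ... | yes (i , l , ρil≡r) with FullFrom-extend {Q = λ v → S′ (𝒴 i , v)} l
           (subtree i (toℕ l) (λ p p<l → ℕ.<-≤-trans (ρ-increasing i p<l) (ℕ.≤-reflexive ρil≡r))
             (ℕ.<⇒≤ (Fin.toℕ<n l))) M
    ...   | a , M<a , ext = a , M<a , extends
      where
      extends : Extends a
      extends i′ l′ ρi′l′≡r
        with opposite-injective (≋⇒level i i′ (opposite l) (opposite l′)
               (ρ≡⇒≋ (trans ρil≡r (sym ρi′l′≡r))))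
      ... | refl = subst (λ b → FullFrom (λ v → S′ (b , v)) (suc (toℕ l)) (vector val′ i′))
        (≋⇒𝒴 i i′ (opposite l) (ρ≡⇒≋ ρ≡))
        (ext (vector val′ i′)
          (λ {p} p<l → begin
            lookup (vector val i) p     ≡⟨ agree {a} {i} {l} ρ<r p p<l ⟩
            lookup (vector val′ i) p    ≡⟨ lookup-vector val′ i p ⟩
            val′ (ρ i p)                ≡⟨ cong val′ (ρ-prefix ρ≡ p<l) ⟩
            val′ (ρ i′ p)               ≡⟨ lookup-vector val′ i′ p ⟨
            lookup (vector val′ i′) p   ∎)
          (trans (lookup-vector val′ i′ l) (update-same val r a ρi′l′≡r)))
        where
        open ≡-Reasoning
        val′ = update val r a
        ρ<r : ∀ p → p Fin.< l → ρ i p < r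
        ρ<r p p<l = subst (ρ i p <_) ρil≡r (ρ-increasing i p<l)
        ρ≡ : ρ i l ≡ ρ i′ l
        ρ≡ = trans ρil≡r (sym ρi′l′≡r)

    a    = proj₁ extension
    val′ = update val r a

    chosen′ : Chosen (suc r) val′
    chosen′ = record { increasing = increasing′ ; subtree = subtree′ }
      where
      increasing′ : ∀ {s s′} → s < s′ → s′ < suc r → val′ s < val′ s′
      increasing′ {s} {s′} s<s′ (s≤s s′≤r) with ℕ.m≤n⇒m<n∨m≡n s′≤r
      ... | inj₁ s′<r = subst₂ _<_
        (sym (update-other val r a (ℕ.<⇒≢ (ℕ.<-trans s<s′ s′<r))))
        (sym (update-other val r a (ℕ.<⇒≢ s′<r)))
        (increasing s<s′ s′<r)
      ... | inj₂ s′≡r = subst₂ _<_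
        (sym (update-other val r a (ℕ.<⇒≢ s<r))) (sym (update-same val r a s′≡r))
        (ℕ.≤-<-trans (val≤M s<r) (proj₁ (proj₂ extension)))
        where
        s<r : s < r
        s<r = ℕ.<-≤-trans s<s′ s′≤r

      subtree′ : ∀ i l → (∀ p → toℕ p < l → ρ i p < suc r) → l ≤ d → Subtree i l (vector val′ i)
      subtree′ i zero    _    _   = full (𝒴 i)
      subtree′ i (suc l) ρ<1+r l<d with ℕ.m≤n⇒m<n∨m≡n (ℕ.≤-pred (ρ<1+r p₁ (s≤s (ℕ.≤-reflexive toℕp₁))))
        where
        p₁ = fromℕ< l<d
        toℕp₁ = Fin.toℕ-fromℕ< l<d
      ... | inj₁ ρ₁<r = FullFrom-cong {Q = λ v → S′ (𝒴 i , v)} (suc l) {vector val i} {vector val′ i}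
        (λ p p<1+l → trans (lookup-vector val i p) (trans
          (sym (update-other val r a (ℕ.<⇒≢ (ρ<r p p<1+l)))) (sym (lookup-vector val′ i p))))
        (subtree i (suc l) ρ<r l<d)
        where
        ρ<r : ∀ p → toℕ p < suc l → ρ i p < r
        ρ<r p (s≤s p≤l) with ℕ.m≤n⇒m<n∨m≡n p≤l
        ... | inj₁ p<l = ℕ.<-trans
          (ρ-increasing i (subst (toℕ p <_) (sym (Fin.toℕ-fromℕ< l<d)) p<l)) ρ₁<r
        ... | inj₂ p≡l = subst (λ p → ρ i p < r)
          (Fin.toℕ-injective (trans (Fin.toℕ-fromℕ< l<d) (sym p≡l))) ρ₁<r
      ... | inj₂ ρ₁≡r = subst (λ l → Subtree i (suc l) (vector val′ i)) (Fin.toℕ-fromℕ< l<d)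
        (proj₂ (proj₂ extension) i (fromℕ< l<d) ρ₁≡r)

  choice : ∀ r → ∃ (Chosen r)
  choice zero    = _ , choose-first
  choice (suc r) = _ , Next.chosen′ (proj₂ (choice r))

  val : ℕ → ℕ
  val = proj₁ (choice bound)

  open Chosen (proj₂ (choice bound))

  tuple : Vec (NF d k) n
  tuple = assemble 𝒴 (val ∘ rank)

  tuple⊆S′ : All S′ tuple
  tuple⊆S′ = All.tabulate⁺ λ i → FullFrom-all (vector val i)
    (subtree i d (λ p _ → rank<bound (i , opposite p)) ℕ.≤-refl)

  tuple-matches : Matches 𝒴 _⪯_ tuple
  tuple-matches = record
    { block = assemble-block 𝒴 (val ∘ rank)
    ; ⪯⇒≤   = λ {a} {b} a⪯b → subst₂ _≤_ (sym (coef≡ a)) (sym (coef≡ b))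
                (val-mono (rank-mono a⪯b) (rank<bound b))
    ; ≤⇒⪯   = λ {a} {b} a≤b → rank-cancel (ℕ.≮⇒≥ λ rb<ra → ℕ.<⇒≱ (increasing rb<ra (rank<bound a))
                (subst₂ _≤_ (coef≡ a) (coef≡ b) a≤b))
    }
    where
    coef≡ = assemble-coef 𝒴 (val ∘ rank)
    val-mono : ∀ {s s′} → s ≤ s′ → s′ < bound → val s ≤ val s′
    val-mono s≤s′ s′<b with ℕ.m≤n⇒m<n∨m≡n s≤s′
    ... | inj₁ s<s′ = ℕ.<⇒≤ (increasing s<s′ s′<b)
    ... | inj₂ refl = ℕ.≤-refl

unique-lookup : ∀ {A : Set} {xs : List A} → Unique xs →
                ∀ i j → List.lookup xs i ≡ List.lookup xs j → i ≡ j
unique-lookup (x∉ ∷ _) zero    zero    _  = refl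
unique-lookup (x∉ ∷ _) zero    (suc j) eq = contradiction eq (ListAll.lookup x∉ (List.∈-lookup j))
unique-lookup (x∉ ∷ _) (suc i) zero    eq = contradiction (sym eq) (ListAll.lookup x∉ (List.∈-lookup i))
unique-lookup (_ ∷ u)  (suc i) (suc j) eq = cong suc (unique-lookup u i j eq)

module LowerBound (em : ExcludedMiddle 0ℓ) {n d k : ℕ}
                  {P : ℕ} (cr : Fin P → Pair n d k) (cr-isCR : ∀ q → CR n d k (cr q))
                  (cr-injective : ∀ q q′ → cr q ≡ cr q′ → q ≡ q′) where

  COL : (ω^ d · k) choose n → Fin (suc P)
  COL s with em {∃ λ q → Realizes (cr q) s}
  ... | yes (q , _) = suc q
  ... | no _        = zero

  COL-realizes : ∀ q {s} → Realizes (cr q) s → COL s ≡ suc q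
  COL-realizes q {s} real with em {∃ λ q → Realizes (cr q) s}
  ... | yes (q′ , real′) = cong suc (cr-injective q′ q
    (realizes-unique {s = s} (cr-isCR q′) (cr-isCR q) real′ real))
  ... | no ∄q            = contradiction (q , real) ∄q

  realized : ∀ q {S′} → OrderEquivalent (ω^ d · k) S′ → ∃ λ s → _⊆ˢ_ (ω^ d · k) s S′ × Realizes (cr q) s
  realized q S′≈ =
    let s , s≐ = choose-exists (key-increasing⇒distinct (key-increasing (cr-isCR q) tuple-matches))
    in s , All-tabulate (λ z∈ → All.lookup tuple⊆S′ (proj₁ s≐ z∈)) , tuple , tuple-matches , s≐
    where open Realization em (cr-isCR q) (Fullness.orderEquivalent⇒full em S′≈)

  P≤∣image∣ : ∀ {S′ C} → OrderEquivalent (ω^ d · k) S′ → IsImage (ω^ d · k) COL S′ C → P ≤ ∣ C ∣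
  P≤∣image∣ {S′} {b ∷ C} S′≈ isImage = begin
    P                ≡⟨ Subset.∣⊤∣≡n P ⟨
    ∣ Subset.⊤ {P} ∣  ≤⟨ Subset.p⊆q⇒∣p∣≤∣q∣ {p = Subset.⊤} (λ {q} _ → q∈C q) ⟩
    ∣ C ∣             ≤⟨ Subset.∣p∣≤∣x∷p∣ b C ⟩
    ∣ b ∷ C ∣         ∎
    where
    open ℕ.≤-Reasoning
    q∈C : ∀ q → q Subset.∈ C
    q∈C q = let s , s⊆ , real = realized q S′≈ in
      Subset.drop-there (Equivalence.from (isImage (suc q)) (s , s⊆ , COL-realizes q real))

lower-bound : ExcludedMiddle 0ℓ → ∀ n d k t → Bounds (ω^ d · k) n t → P[ n ,ω^ d · k ] ≤ t
lower-bound em n d k t bounds =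
  let open LowerBound em (List.lookup (CRs n d k)) (cr-at n d k) (unique-lookup (CRs-unique n d k))
      S′ , S′≈ , C , isImage , ∣C∣≤t = bounds _ (s≤s z≤n) COL
  in ℕ.≤-trans (P≤∣image∣ S′≈ isImage) ∣C∣≤t

theorem9p4 : ExcludedMiddle 0ℓ → ∀ (n d k : ℕ) →
    (∀ (τ : ℕ∞) → T[ n , ω^ d · k ]≡ τ → [ P[ n ,ω^ d · k ] ] ≤∞ τ)
    × (T[ n , ω^ d · k ]≡ [ P[ n ,ω^ d · k ] ])
theorem9p4 em n d k = ≤T , upper-bound em n d k , lower-bound em n d k
  where
  ≤T : ∀ τ → T[ n , ω^ d · k ]≡ τ → [ P[ n ,ω^ d · k ] ] ≤∞ τ
  ≤T [ t ] (bounds , _) = [ lower-bound em n d k t bounds ]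
  ≤T ⊤⁺    _            = _ ≤⊤⁺
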